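{- There exists an absolute constant $C>0$ such that for every integer $p\ge 1$, every graph $G=(V,E,\ell)$ of treewidth $p$ with nonnegative edge lengths, and every set $R\subseteq V$ of $k$ terminals, $G$ admits a distance-preserving minor $G'=(V',E',\ell')$ with respect to $R$ with $|V'|\le C p^3 k$. In other words, $f^*(k,\mathrm{TW}(p))\le Cp^3k$, where $\mathrm{TW}(p)$ is the family of graphs of treewidth at most $p$.
   Context: $d_H$ denotes shortest-path distance in a graph $H$ with respect to its edge lengths. Given a graph $G=(V,E,\ell)$ and terminals $R\subseteq V$, a distance-preserving minor of $G$ with respect to $R$ is a graph $G'$ with edge lengths $\ell'$ (which may differ from $\ell$) such that $G'$ is a minor of $G$ in which the terminals survive (terminals are never deleted and no two terminals are merged; a terminal may be merged with non-terminals by contraction and the resulting vertex is identified with that terminal), so $R\subseteq V(G')$, and $d_{G'}(u,v)=d_G(u,v)$ for all $u,v\in R$. For a family $\mathcal{F}$ of graphs, $f^*(k,\mathcal{F})$ is the minimum number such that every graph in $\mathcal{F}$, with any nonnegative edge lengths and any $k$ terminals, admits a distance-preserving minor with at most $f^*(k,\mathcal{F})$ vertices.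
   Formalization: The edge lengths of G (and of the minor G') are nonnegative rational numbers instead of nonnegative real numbers. -}

module Defs where

open import Data.Nat using (ℕ; zero; suc; _≤_)
open import Data.Fin using (Fin; toℕ) renaming (suc to fsuc; zero to fzero)
open import Data.Bool using (Bool; T)
open import Data.Maybe using (Maybe; just)
open import Data.List using (List; length)
open import Data.List.Membership.Propositional using (_∈_)
open import Data.Product using (Σ; _×_; _,_; ∃; ∃-syntax)
open import Data.Sum using (_⊎_)
open import Data.Rational using (ℚ; 0ℚ; _+_) renaming (_≤_ to _≤ℚ_)
open import Relation.Binary.PropositionalEquality using (_≡_)
open import Function using (_⇔_)
open import Function.Definitions using (Injective)

data Walk {A : Set} (E : A → A → Set) : A → A → Set where
  [] : ∀ {u} → Walk E u u
  _∷_ : ∀ {u w v} → E u w → Walk E w v → Walk E u v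

AllOn : {A : Set} {E : A → A → Set} (S : A → Set) {u v : A} → Walk E u v → Set
AllOn S {u} [] = S u
AllOn S {u} (_ ∷ w) = S u × AllOn S w

record Graph : Set where
  field
    n     : ℕ
    adj   : Fin n → Fin n → Bool
    sym   : ∀ u v → adj u v ≡ adj v u
    irr   : ∀ u → adj u u ≡ Data.Bool.false

  Adj : Fin n → Fin n → Set
  Adj u v = T (adj u v)

open Graph public

record WGraph : Set where
  field
    graph  : Graph
    len    : Fin (n graph) → Fin (n graph) → ℚ
    lenSym : ∀ u v → len u v ≡ len v u
    lenNonneg : ∀ u v → 0ℚ ≤ℚ len u v

open WGraph public

walkLength : (G : WGraph) {u v : Fin (n (graph G))} → Walk (Adj (graph G)) u v → ℚ
walkLength G [] = 0ℚ
walkLength G (_∷_ {u} {w} _ p) = len G u w + walkLength G p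

-- d_G(u,v) ≤ q  (there is a walk of length at most q; d = ∞ if none)
DistAtMost : (G : WGraph) → Fin (n (graph G)) → Fin (n (graph G)) → ℚ → Set
DistAtMost G u v q = Σ (Walk (Adj (graph G)) u v) (λ p → walkLength G p ≤ℚ q)

-- Tree decompositions and treewidth
-- A tree on nodes Fin (suc m): node (fsuc i) has a parent with smaller index.
-- (Every finite tree admits such a labelling.)

record TreeDecomposition (G : Graph) (p : ℕ) : Set where
  field
    m      : ℕ
    parent : Fin m → Fin (suc m)
    parent< : ∀ i → toℕ (parent i) ≤ toℕ i
    bag    : Fin (suc m) → List (Fin (n G))
    bagSize : ∀ t → length (bag t) ≤ suc p
    coverV : ∀ v → ∃[ t ] (v ∈ bag t)
    coverE : ∀ u v → Adj G u v → ∃[ t ] (u ∈ bag t × v ∈ bag t)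

  TreeAdj : Fin (suc m) → Fin (suc m) → Set
  TreeAdj a b = (∃[ i ] (a ≡ fsuc i × b ≡ parent i))
              ⊎ (∃[ i ] (b ≡ fsuc i × a ≡ parent i))

  field
    subtree : ∀ v t t' → v ∈ bag t → v ∈ bag t' →
              Σ (Walk TreeAdj t t') (AllOn (λ s → v ∈ bag s))

TreewidthAtMost : Graph → ℕ → Set
TreewidthAtMost G p = TreeDecomposition G p

-- Distance-preserving minors (branch-set description of minors)
-- terminals : Fin k → V(G) injective (the terminal set R, |R| = k)

record DPMinor (G : WGraph) (k : ℕ) (term : Fin k → Fin (n (graph G)))
               (G' : WGraph) : Set where
  private
    V  = Fin (n (graph G))
    V' = Fin (n (graph G'))
  field
    -- φ v = just x : v lies in branch set of x; nothing : v deleted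
    φ        : V → Maybe V'
    branchNonempty : ∀ (x : V') → ∃[ v ] (φ v ≡ just x)
    branchConnected : ∀ (x : V') (u v : V) → φ u ≡ just x → φ v ≡ just x →
                      Σ (Walk (Adj (graph G)) u v) (AllOn (λ w → φ w ≡ just x))
    edgesRealised : ∀ (x y : V') → Adj (graph G') x y →
                    ∃[ u ] ∃[ v ] (φ u ≡ just x × φ v ≡ just y × Adj (graph G) u v)
    τ        : Fin k → V'
    τInj     : Injective _≡_ _≡_ τ
    τBranch  : ∀ i → φ (term i) ≡ just (τ i)
    -- distances between terminals are preserved: d_G' = d_G (including ∞)
    preserves : ∀ i j q → DistAtMost G (term i) (term j) q ⇔ DistAtMost G' (τ i) (τ j) q

{-# OPTIONS --safe #-}

-- Shortest paths are made unique by perturbing the lengths, so that two of them meet in a common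
-- subpath. A graph covered by regions that overlap only in boundary vertices then has a
-- distance-preserving minor with at most ∑ |∂ᵢ|⁴ vertices: keep the first common vertex of any two
-- (directed) shortest paths joining boundary vertices of the same region, and contract what lies
-- between consecutive kept vertices on such a path. Cutting along O(k/p) bags of the tree
-- decomposition gives regions with boundaries of size O(p), and (k/p) p⁴ = p³ k.
module Submission where

open import Defs
open import Data.Nat as ℕ using (ℕ; zero; suc; _+_; _*_; _∸_; _^_; _≤_; _<_; z≤n; s≤s; s≤s⁻¹)
import Data.Nat.Properties as ℕ
open import Data.Nat.Induction using (<-wellFounded)
open import Data.Nat.Tactic.RingSolver using (solve-∀)
open import Induction.WellFounded using (Acc; acc)
import Data.Integer as ℤ
import Data.Integer.Properties as ℤ
open import Data.Rational as ℚ using (ℚ; 0ℚ; mkℚ)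
import Data.Rational.Properties as ℚ
open import Data.Rational.Unnormalised as ℚᵘ using (mkℚᵘ; *≡*)
import Data.Rational.Unnormalised.Properties as ℚᵘ
open import Algebra.Properties.Monoid.Mult ℚ.+-0-monoid using (×-homo-+; ×-assocˡ) renaming (_×_ to _·_)
open import Data.Fin as Fin using (Fin; toℕ; fromℕ<)
import Data.Fin.Properties as Fin
open import Data.Bool using (T; T?)
open import Data.Maybe using (Maybe; just; nothing)
open import Data.List using (List; []; _∷_; length; _++_; lookup; allFin; cartesianProduct; map; filter; concat; tabulate; deduplicate)
open import Data.List.Properties using (length-++; length-map; length-filter; length-deduplicate; length-tabulate)
open import Data.List.Extrema ℕ.≤-totalOrder using (argmin; argmin-all; f[argmin]≤f[xs])
import Data.List.Membership.DecPropositional as DecMembership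
open import Data.List.Membership.Propositional using (_∈_; _∉_)
open import Data.List.Membership.Propositional.Properties using (∈-++⁺ˡ; ∈-++⁺ʳ; ∈-++⁻; ∈-allFin; ∈-lookup; ∈-map⁺; ∈-cartesianProduct⁺; ∈-filter⁺; ∈-filter⁻; ∈-deduplicate⁺; ∈-concat⁺′; ∈-tabulate⁺)
open import Data.List.Relation.Unary.All as All using (All; []; _∷_)
import Data.List.Relation.Unary.All.Properties as All
open import Data.List.Relation.Unary.AllPairs using ([]; _∷_)
open import Data.List.Relation.Unary.Any using (here; there; index)
open import Data.List.Relation.Unary.Any.Properties using (lookup-index)
open import Data.List.Relation.Unary.Unique.Propositional using (Unique)
open import Data.List.Relation.Unary.Unique.DecPropositional.Properties using (deduplicate-!)
open import Data.Product using (Σ; _×_; _,_; ∃-syntax; Σ-syntax; proj₁; proj₂)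
open import Data.Sum using (_⊎_; inj₁; inj₂; [_,_]′)
open import Function using (_∘_; case_of_; id; mk⇔)
open import Function.Definitions using (Injective)
open import Relation.Binary.Definitions using (tri<; tri≈; tri>)
open import Relation.Binary.PropositionalEquality as ≡ using (_≡_; _≢_; _≗_; refl; trans; cong; cong₂; subst)
open import Relation.Nullary using (¬_; Dec; yes; no; does; contradiction)
open import Relation.Nullary.Decidable using (map′; _×-dec_; _⊎-dec_; _→-dec_; ¬?; does-⇔; dec-true; dec-false)
open import Relation.Unary using (Decidable)

-- Rational lengths as multiples of a common unit

-- The regions can be treated one at a time because shortest paths between terminals break at
-- portals (the vertices in which regions may overlap): a piece with no portal strictly inside runs
-- within a single region and joins two of its boundary vertices. A vertex that is not kept is not a
-- portal, so it has only one region. Hence all such pieces through it join boundary vertices of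
-- that same region, and the quadruples of boundary vertices taken region by region record every
-- place where two pieces meet or part.
--
-- The perturbation only selects the paths; the edges of the minor carry the original distances, so
-- nothing has to be rounded back.
--
-- The fourth power forces the cutting to control two things at once: closed regions need boundaries
-- of size O(p) and must be few enough for each to be paid for by p units of potential, while the
-- part left at the end must cost O(p^3 k) even when k is much smaller than p.

module CommonDenominator where

  open import Data.Integer using (+_)

  ·-mono-≤ : ∀ {ε} → 0ℚ ℚ.≤ ε → ∀ {a b} → a ℕ.≤ b → a · ε ℚ.≤ b · ε
  ·-mono-≤ 0≤ε {b = zero} ℕ.z≤n = ℚ.≤-refl
  ·-mono-≤ {ε} 0≤ε {b = suc b} ℕ.z≤n =
    subst (ℚ._≤ suc b · ε) (ℚ.+-identityˡ 0ℚ) (ℚ.+-mono-≤ 0≤ε (·-mono-≤ 0≤ε {b = b} ℕ.z≤n))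
  ·-mono-≤ {ε} 0≤ε (ℕ.s≤s a≤b) = ℚ.+-monoʳ-≤ ε (·-mono-≤ 0≤ε a≤b)

  opaque

    unitFraction : ℕ → ℚ
    unitFraction k = ℚ.fromℚᵘ (mkℚᵘ (+ 1) k)

    ·-unitFraction : ∀ m k → m · unitFraction k ≡ ℚ.fromℚᵘ (mkℚᵘ (+ m) k)
    ·-unitFraction zero k = ≡.sym (ℚ.fromℚᵘ-cong {mkℚᵘ (+ 0) k} {ℚᵘ.0ℚᵘ} (*≡* refl))
    ·-unitFraction (suc m) k = trans (cong (unitFraction k ℚ.+_) (·-unitFraction m k)) (ℚ.toℚᵘ-injective (begin
      ℚ.toℚᵘ (unitFraction k ℚ.+ ℚ.fromℚᵘ (mkℚᵘ (+ m) k))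
        ≈⟨ ℚ.toℚᵘ-homo-+ (unitFraction k) (ℚ.fromℚᵘ (mkℚᵘ (+ m) k)) ⟩
      ℚ.toℚᵘ (unitFraction k) ℚᵘ.+ ℚ.toℚᵘ (ℚ.fromℚᵘ (mkℚᵘ (+ m) k))
        ≈⟨ ℚᵘ.+-cong (ℚ.toℚᵘ-fromℚᵘ (mkℚᵘ (+ 1) k)) (ℚ.toℚᵘ-fromℚᵘ (mkℚᵘ (+ m) k)) ⟩
      mkℚᵘ (+ 1) k ℚᵘ.+ mkℚᵘ (+ m) k
        ≈⟨ ℚᵘ.≃-reflexive (cong (λ x → mkℚᵘ x (k ℕ.+ k ℕ.* suc k)) (ℤ.*-distribʳ-+ (+ suc k) (+ 1) (+ m))) ⟨
      mkℚᵘ ((+ suc m) ℤ.* + suc k) (k ℕ.+ k ℕ.* suc k)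
        ≈⟨ *≡* (ℤ.*-assoc (+ suc m) (+ suc k) (+ suc k)) ⟩
      mkℚᵘ (+ suc m) k
        ≈⟨ ℚ.toℚᵘ-fromℚᵘ (mkℚᵘ (+ suc m) k) ⟨
      ℚ.toℚᵘ (ℚ.fromℚᵘ (mkℚᵘ (+ suc m) k)) ∎))
      where open ℚᵘ.≃-Reasoning

    commonDenominator : ∀ (qs : List ℚ) → All (0ℚ ℚ.≤_) qs → ∃[ k ] All (λ q → ∃[ m ] (q ≡ m · unitFraction k)) qs
    commonDenominator [] [] = 0 , []
    commonDenominator (q ∷ qs) (0≤q ∷ 0≤qs) with commonDenominator qs 0≤qs
    ... | k , multiples = k′ , integral q 0≤q ∷ All.map refine multiples
      where
      b : ℕ
      b = ℚ.ℚ.denominator-1 q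
      -- `suc k′` is the product `suc k * suc b` of the denominators, each of which is stored minus
      -- one.
      k′ : ℕ
      k′ = b ℕ.+ k ℕ.* suc b

      refineUnit : unitFraction k ≡ suc b · unitFraction k′
      refineUnit = ≡.sym (trans (·-unitFraction (suc b) k′) (ℚ.fromℚᵘ-cong {mkℚᵘ (+ suc b) k′} {mkℚᵘ (+ 1) k} (*≡* (begin
        + suc b ℤ.* + suc k ≡⟨ ℤ.*-comm (+ suc b) (+ suc k) ⟩
        + suc k ℤ.* + suc b ≡⟨ ℤ.*-identityˡ (+ suc k′) ⟨
        + 1 ℤ.* + suc k′ ∎))))
        where open ≡.≡-Reasoning

      refine : ∀ {r} → ∃[ m ] (r ≡ m · unitFraction k) → ∃[ m ] (r ≡ m · unitFraction k′)
      refine (m , refl) = m ℕ.* suc b , trans (cong (m ·_) refineUnit) (×-assocˡ (unitFraction k′) m (suc b))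

      integral : ∀ r → 0ℚ ℚ.≤ r → ∃[ m ] (r ≡ m · unitFraction (ℚ.ℚ.denominator-1 r ℕ.+ k ℕ.* suc (ℚ.ℚ.denominator-1 r)))
      integral (mkℚ (+ a) c coprime) _ = a ℕ.* suc k , trans (≡.sym (ℚ.fromℚᵘ-toℚᵘ (mkℚ (+ a) c coprime)))
        (trans (ℚ.fromℚᵘ-cong {mkℚᵘ (+ a) c} {mkℚᵘ (+ (a ℕ.* suc k)) (c ℕ.+ k ℕ.* suc c)} (*≡* (begin
          + a ℤ.* (+ suc k ℤ.* + suc c) ≡⟨ ℤ.*-assoc (+ a) (+ suc k) (+ suc c) ⟨
          + a ℤ.* + suc k ℤ.* + suc c ≡⟨ cong (ℤ._* + suc c) (ℤ.pos-* a (suc k)) ⟨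
          + (a ℕ.* suc k) ℤ.* + suc c ∎)))
          (≡.sym (·-unitFraction (a ℕ.* suc k) (c ℕ.+ k ℕ.* suc c))))
        where open ≡.≡-Reasoning
      integral (mkℚ (ℤ.-[1+ a ]) c coprime) (ℚ.*≤* ())

    0≤unitFraction : ∀ k → 0ℚ ℚ.≤ unitFraction k
    0≤unitFraction k = ℚ.nonNegative⁻¹ (unitFraction k) {{ℚ.normalize-nonNeg 1 (suc k)}}

open CommonDenominator

-- Walks

module _ {A : Set} {E : A → A → Set} where

  _◅◅_ : ∀ {u v w} → Walk E u v → Walk E v w → Walk E u w
  [] ◅◅ q = q
  (e ∷ p) ◅◅ q = e ∷ (p ◅◅ q)

  AllOn-start : ∀ {S : A → Set} {u v} (p : Walk E u v) → AllOn S p → S u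
  AllOn-start [] s = s
  AllOn-start (_ ∷ _) (s , _) = s

  AllOn-◅◅ : ∀ {S : A → Set} {u v w} (p : Walk E u v) (q : Walk E v w) →
             AllOn S p → AllOn S q → AllOn S (p ◅◅ q)
  AllOn-◅◅ [] q _ sq = sq
  AllOn-◅◅ (e ∷ p) q (s , sp) sq = s , AllOn-◅◅ p q sp sq

  module _ (E-sym : ∀ {u v} → E u v → E v u) where

    reverse : ∀ {u v} → Walk E u v → Walk E v u
    reverse [] = []
    reverse (e ∷ p) = reverse p ◅◅ (E-sym e ∷ [])

    AllOn-reverse : ∀ {S : A → Set} {u v} (p : Walk E u v) → AllOn S p → AllOn S (reverse p)
    AllOn-reverse [] s = s
    AllOn-reverse (e ∷ p) (s , sp) = AllOn-◅◅ (reverse p) (E-sym e ∷ []) (AllOn-reverse p sp) (AllOn-start p sp , s)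

  vertices : ∀ {u v} → Walk E u v → List A
  vertices {u} [] = u ∷ []
  vertices {u} (_ ∷ p) = u ∷ vertices p

  ∈-vertices-◅◅ : ∀ {u v w x} (p : Walk E u v) (q : Walk E v w) →
                  x ∈ vertices (p ◅◅ q) → x ∈ vertices p ⊎ x ∈ vertices q
  ∈-vertices-◅◅ [] q x∈ = inj₂ x∈
  ∈-vertices-◅◅ (e ∷ p) q (here x≡) = inj₁ (here x≡)
  ∈-vertices-◅◅ (e ∷ p) q (there x∈) with ∈-vertices-◅◅ p q x∈
  ... | inj₁ x∈p = inj₁ (there x∈p)
  ... | inj₂ x∈q = inj₂ x∈q

  start∈vertices : ∀ {u v} (p : Walk E u v) → u ∈ vertices p
  start∈vertices [] = here refl
  start∈vertices (_ ∷ _) = here refl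

  middle∈vertices : ∀ {u v w} (p : Walk E u v) (q : Walk E v w) → v ∈ vertices (p ◅◅ q)
  middle∈vertices [] q = start∈vertices q
  middle∈vertices (_ ∷ p) q = there (middle∈vertices p q)

  module _ (f : A → A → ℕ) where

    weight : ∀ {u v} → Walk E u v → ℕ
    weight [] = 0
    weight (_∷_ {u} {w} _ p) = f u w + weight p

    weight-◅◅ : ∀ {u v w} (p : Walk E u v) (q : Walk E v w) → weight (p ◅◅ q) ≡ weight p + weight q
    weight-◅◅ [] q = refl
    weight-◅◅ (_∷_ {u} {w} e p) q = trans (cong (f u w +_) (weight-◅◅ p q)) (≡.sym (ℕ.+-assoc (f u w) _ _))

    weight-reverse : (E-sym : ∀ {u v} → E u v → E v u) → (∀ u v → f u v ≡ f v u) →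
                     ∀ {u v} (p : Walk E u v) → weight (reverse E-sym p) ≡ weight p
    weight-reverse E-sym f-sym [] = refl
    weight-reverse E-sym f-sym (_∷_ {u} {w} e p) = begin
      weight (reverse E-sym p ◅◅ (E-sym e ∷ [])) ≡⟨ weight-◅◅ (reverse E-sym p) _ ⟩
      weight (reverse E-sym p) + (f w u + 0) ≡⟨ cong₂ _+_ (weight-reverse E-sym f-sym p) (ℕ.+-identityʳ (f w u)) ⟩
      weight p + f w u ≡⟨ ℕ.+-comm (weight p) (f w u) ⟩
      f w u + weight p ≡⟨ cong (_+ weight p) (f-sym w u) ⟩
      f u w + weight p ∎
      where open ≡.≡-Reasoning

    split : ∀ {u v x} (p : Walk E u v) → x ∈ vertices p →
            Σ[ p₁ ∈ Walk E u x ] Σ[ p₂ ∈ Walk E x v ] (weight p₁ + weight p₂ ≡ weight p)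
    split [] (here refl) = [] , [] , refl
    split (e ∷ p) (here refl) = [] , (e ∷ p) , refl
    split (_∷_ {u} {w} e p) (there x∈) with split p x∈
    ... | p₁ , p₂ , eq = e ∷ p₁ , p₂ , trans (ℕ.+-assoc (f u w) _ _) (cong (f u w +_) eq)

    simpleSuffix : ∀ {u v x} (p : Walk E u v) → Unique (vertices p) → x ∈ vertices p →
                   Σ[ q ∈ Walk E x v ] (Unique (vertices q) × weight q ≤ weight p)
    simpleSuffix [] uniq (here refl) = [] , uniq , z≤n
    simpleSuffix (e ∷ p) uniq (here refl) = e ∷ p , uniq , ℕ.≤-refl
    simpleSuffix (e ∷ p) (_ ∷ uniq) (there x∈) with simpleSuffix p uniq x∈
    ... | q , uniq′ , q≤p = q , uniq′ , ℕ.m≤n⇒m≤o+n _ q≤p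

  length-vertices : ∀ {u v} (p : Walk E u v) → length (vertices p) ≡ suc (weight (λ _ _ → 1) p)
  length-vertices [] = refl
  length-vertices (_ ∷ p) = cong suc (length-vertices p)

-- Simple walks, decidable connectivity and lightest walks.

lookup-injective : ∀ {A : Set} {xs : List A} → Unique xs → ∀ i j → lookup xs i ≡ lookup xs j → i ≡ j
lookup-injective (_ ∷ _) Fin.zero Fin.zero _ = refl
lookup-injective (x∉ ∷ _) Fin.zero (Fin.suc j) eq = contradiction eq (All.lookup x∉ (∈-lookup j))
lookup-injective (x∉ ∷ _) (Fin.suc i) Fin.zero eq = contradiction (≡.sym eq) (All.lookup x∉ (∈-lookup i))
lookup-injective (_ ∷ uniq) (Fin.suc i) (Fin.suc j) eq = cong Fin.suc (lookup-injective uniq i j eq)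

least : ∀ {P : ℕ → Set} → (∀ q → Dec (P q)) → ∀ q → P q → ∃[ m ] (P m × ∀ k → P k → m ≤ k)
least P? zero p = zero , p , λ _ _ → z≤n
least P? (suc q) p with P? zero
... | yes p₀ = zero , p₀ , λ _ _ → z≤n
... | no ¬p₀ with least (P? ∘ suc) q p
...   | m , pm , min = suc m , pm , λ { zero p₀ → contradiction p₀ ¬p₀ ; (suc k) pk → s≤s (min k pk) }

module _ {n : ℕ} where

  open DecMembership (Fin._≟_ {n}) using (_∈?_)

  simplify : ∀ {E : Fin n → Fin n → Set} (f : Fin n → Fin n → ℕ) {u v} (p : Walk E u v) →
             Σ[ q ∈ Walk E u v ] (Unique (vertices q) × weight f q ≤ weight f p)
  simplify f [] = [] , ([] ∷ []) , z≤n
  simplify f (_∷_ {u} {w} e p) with simplify f p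
  ... | q , uniq , q≤p with u ∈? vertices q
  ...   | yes u∈q = let q′ , uniq′ , q′≤q = simpleSuffix f q uniq u∈q
                    in q′ , uniq′ , ℕ.≤-trans q′≤q (ℕ.m≤n⇒m≤o+n (f u w) q≤p)
  ...   | no u∉q = e ∷ q , All.¬Any⇒All¬ _ u∉q ∷ uniq , ℕ.+-monoʳ-≤ (f u w) q≤p

  length-Unique≤ : {xs : List (Fin n)} → Unique xs → length xs ≤ n
  length-Unique≤ {xs} uniq = Fin.injective⇒≤ {f = lookup xs} (λ {i} {j} → lookup-injective uniq i j)

  module _ {E : Fin n → Fin n → Set} (E? : ∀ u v → Dec (E u v)) where

    -- Positive weights make every edge use up part of the total, so a search by first edge recurses
    -- on a smaller remainder; `fuel` bounds that remainder.
    walkOfWeight? : (f : Fin n → Fin n → ℕ) → (∀ u v → 0 < f u v) →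
                    ∀ u v q → Dec (Σ[ p ∈ Walk E u v ] weight f p ≡ q)
    walkOfWeight? f f>0 u v q = search q u v q ℕ.≤-refl
      where
      search : ∀ fuel u v q → q ≤ fuel → Dec (Σ[ p ∈ Walk E u v ] weight f p ≡ q)
      search _ u v zero _ = map′ (λ { refl → [] , refl }) empty (u Fin.≟ v)
        where
        empty : Σ[ p ∈ Walk E u v ] weight f p ≡ 0 → u ≡ v
        empty ([] , _) = refl
        empty (_∷_ {u} {w} _ p , eq) = contradiction (ℕ.m+n≡0⇒m≡0 (f u w) eq) (ℕ.>⇒≢ (f>0 u w))
      search (suc fuel) u v (suc q) q≤ = map′ join first
        (Fin.any? λ w → E? u w ×-dec f u w ℕ.≤? suc q ×-dec
           search fuel w v (suc q ∸ f u w) (ℕ.≤-trans (ℕ.∸-monoʳ-≤ (suc q) (f>0 u w)) (s≤s⁻¹ q≤)))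
        where
        join : ∃[ w ] (E u w × f u w ≤ suc q × Σ[ p ∈ Walk E w v ] weight f p ≡ suc q ∸ f u w) →
               Σ[ p ∈ Walk E u v ] weight f p ≡ suc q
        join (w , e , f≤ , p , eq) = e ∷ p , trans (cong (f u w +_) eq) (ℕ.m+[n∸m]≡n f≤)
        first : Σ[ p ∈ Walk E u v ] weight f p ≡ suc q →
                ∃[ w ] (E u w × f u w ≤ suc q × Σ[ p ∈ Walk E w v ] weight f p ≡ suc q ∸ f u w)
        first (_∷_ {w = w} e p , eq) = w , e , subst (f u w ≤_) eq (ℕ.m≤m+n (f u w) _) ,
          p , trans (≡.sym (ℕ.m+n∸m≡n (f u w) _)) (cong (_∸ f u w) eq)

    -- Any walk can be replaced by a simple one, which has fewer than `n` edges, so only finitely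
    -- many lengths need testing.
    connected? : ∀ u v → Dec (Walk E u v)
    connected? u v = map′ (λ { (_ , p , _) → p }) short
      (Fin.any? λ (c : Fin n) → walkOfWeight? (λ _ _ → 1) (λ _ _ → s≤s z≤n) u v (toℕ c))
      where
      short : Walk E u v → ∃[ c ] Σ[ p ∈ Walk E u v ] weight (λ _ _ → 1) p ≡ toℕ {n} c
      short p with simplify (λ _ _ → 1) p
      ... | q , uniq , _ = fromℕ< q<n , q , ≡.sym (Fin.toℕ-fromℕ< q<n)
        where q<n = ℕ.≤-trans (ℕ.≤-reflexive (≡.sym (length-vertices q))) (length-Unique≤ uniq)

    lightestWalk : (f : Fin n → Fin n → ℕ) → (∀ u v → 0 < f u v) → ∀ {u v} → Walk E u v →
                   Σ[ p ∈ Walk E u v ] (∀ q → weight f p ≤ weight f q)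
    lightestWalk f f>0 {u} {v} p with least (walkOfWeight? f f>0 u v) (weight f p) (p , refl)
    ... | _ , (q , refl) , min = q , λ r → min (weight f r) (r , refl)

-- Vertex sets encoded as binary numbers.

binary : ∀ {n} → (Fin n → ℕ) → ℕ
binary {zero} f = 0
binary {suc n} f = f Fin.zero + 2 * binary (f ∘ Fin.suc)

binary-cong : ∀ {n} {f g : Fin n → ℕ} → f ≗ g → binary f ≡ binary g
binary-cong {zero} f≗g = refl
binary-cong {suc n} f≗g = cong₂ (λ a b → a + 2 * b) (f≗g Fin.zero) (binary-cong (f≗g ∘ Fin.suc))

-- Digits are not limited to 0 and 1, so nothing is carried; this makes the code of a walk additive
-- over its vertices. The bound on digits enters only for size and injectivity.
binary-+ : ∀ {n} (f g : Fin n → ℕ) → binary (λ x → f x + g x) ≡ binary f + binary g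
binary-+ {zero} f g = refl
binary-+ {suc n} f g = trans (cong (λ t → f Fin.zero + g Fin.zero + 2 * t) (binary-+ (f ∘ Fin.suc) (g ∘ Fin.suc)))
  (rearrange (f Fin.zero) (g Fin.zero) (binary (f ∘ Fin.suc)) (binary (g ∘ Fin.suc)))
  where
  rearrange : ∀ a b c d → a + b + 2 * (c + d) ≡ a + 2 * c + (b + 2 * d)
  rearrange = solve-∀

binary-zero : ∀ n → binary {n} (λ _ → 0) ≡ 0
binary-zero zero = refl
binary-zero (suc n) = cong (2 *_) (binary-zero n)

binary< : ∀ {n} (f : Fin n → ℕ) → (∀ x → f x ≤ 1) → binary f < 2 ^ n
binary< {zero} f f≤1 = s≤s z≤n
binary< {suc n} f f≤1 = begin-strict
  f Fin.zero + 2 * b ≤⟨ ℕ.+-monoˡ-≤ (2 * b) (f≤1 Fin.zero) ⟩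
  1 + 2 * b <⟨ ℕ.≤-reflexive (double b) ⟩
  2 * suc b ≤⟨ ℕ.*-monoʳ-≤ 2 (binary< (f ∘ Fin.suc) (f≤1 ∘ Fin.suc)) ⟩
  2 ^ suc n ∎
  where
  open ℕ.≤-Reasoning
  b = binary (f ∘ Fin.suc)
  double : ∀ b → 2 + 2 * b ≡ 2 * suc b
  double = solve-∀

digit-injective : ∀ {a b} c d → a ≤ 1 → b ≤ 1 → a + 2 * c ≡ b + 2 * d → a ≡ b × c ≡ d
digit-injective {0} {0} c d _ _ eq = refl , ℕ.*-cancelˡ-≡ c d 2 eq
digit-injective {0} {1} c d _ _ eq = contradiction eq (ℕ.even≢odd c d)
digit-injective {1} {0} c d _ _ eq = contradiction (≡.sym eq) (ℕ.even≢odd d c)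
digit-injective {1} {1} c d _ _ eq = refl , ℕ.*-cancelˡ-≡ c d 2 (ℕ.suc-injective eq)
digit-injective {suc (suc _)} _ _ (s≤s ()) _ _
digit-injective {_} {suc (suc _)} _ _ _ (s≤s ()) _

binary-injective : ∀ {n} {f g : Fin n → ℕ} → (∀ x → f x ≤ 1) → (∀ x → g x ≤ 1) → binary f ≡ binary g → f ≗ g
binary-injective {suc n} {f} {g} f≤1 g≤1 eq = λ
  { Fin.zero → proj₁ digits
  ; (Fin.suc x) → binary-injective (f≤1 ∘ Fin.suc) (g≤1 ∘ Fin.suc) (proj₂ digits) x }
  where digits = digit-injective (binary (f ∘ Fin.suc)) (binary (g ∘ Fin.suc)) (f≤1 Fin.zero) (g≤1 Fin.zero) eq

module _ {n : ℕ} where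

  indicator : Fin n → Fin n → ℕ
  indicator x y with x Fin.≟ y
  ... | yes _ = 1
  ... | no _ = 0

  indicator≡1 : ∀ x → indicator x x ≡ 1
  indicator≡1 x with x Fin.≟ x
  ... | yes _ = refl
  ... | no x≢x = contradiction refl x≢x

  count : List (Fin n) → Fin n → ℕ
  count [] y = 0
  count (x ∷ xs) y = indicator x y + count xs y

  count-∉ : ∀ {xs y} → y ∉ xs → count xs y ≡ 0
  count-∉ {[]} y∉ = refl
  count-∉ {x ∷ xs} {y} y∉ with x Fin.≟ y
  ... | yes x≡y = contradiction (here (≡.sym x≡y)) y∉
  ... | no _ = count-∉ (y∉ ∘ there)

  count-∈ : ∀ {xs y} → y ∈ xs → 0 < count xs y
  count-∈ {x ∷ xs} (here refl) = ℕ.≤-trans (ℕ.≤-reflexive (≡.sym (indicator≡1 x))) (ℕ.m≤m+n _ _)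
  count-∈ {x ∷ xs} (there y∈) = ℕ.≤-trans (count-∈ y∈) (ℕ.m≤n+m _ (indicator x _))

  count-Unique≤1 : ∀ {xs} → Unique xs → ∀ y → count xs y ≤ 1
  count-Unique≤1 {[]} [] y = z≤n
  count-Unique≤1 {x ∷ xs} (x∉ ∷ uniq) y with x Fin.≟ y
  ... | yes refl = s≤s (ℕ.≤-reflexive (count-∉ (All.All¬⇒¬Any x∉)))
  ... | no _ = count-Unique≤1 uniq y

  code : List (Fin n) → ℕ
  code xs = binary (count xs)

  bit : Fin n → ℕ
  bit x = binary (indicator x)

  code-∷ : ∀ x xs → code (x ∷ xs) ≡ bit x + code xs
  code-∷ x xs = binary-+ (indicator x) (count xs)

  code-[] : code [] ≡ 0
  code-[] = binary-zero n

  -- Without repetitions all counts are at most 1, hence they are the true binary digits of the code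
  -- and can be read off from it.
  code-injective : ∀ {xs ys} → Unique xs → Unique ys → code xs ≡ code ys → ∀ {z} → z ∈ xs → z ∈ ys
  code-injective {xs} {ys} uniq uniq′ eq {z} z∈xs with z ∈? ys
    where open DecMembership (Fin._≟_ {n}) using (_∈?_)
  ... | yes z∈ys = z∈ys
  ... | no z∉ys = contradiction
    (trans (binary-injective (count-Unique≤1 uniq) (count-Unique≤1 uniq′) eq z) (count-∉ z∉ys))
    (ℕ.>⇒≢ (count-∈ z∈xs))

-- Keeps the perturbed weight of an edge positive even when its length is zero.
bit>0 : ∀ {n} (x : Fin n) → 0 < bit x
bit>0 {n} x with bit x in eq
... | suc _ = s≤s z≤n
... | zero = contradiction (trans (≡.sym (indicator≡1 x)) (binary-injective {f = indicator x} {g = λ _ → 0} ≤1 (λ _ → z≤n) (trans eq (≡.sym (binary-zero n))) x)) λ ()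
  where
  ≤1 : ∀ y → indicator x y ≤ 1
  ≤1 y with x Fin.≟ y
  ... | yes _ = ℕ.≤-refl
  ... | no _ = z≤n

-- Unique shortest paths

Vertex : WGraph → Set
Vertex G = Fin (n (graph G))

Path : (G : WGraph) → Vertex G → Vertex G → Set
Path G = Walk (Adj (graph G))

Adj-sym : (G : Graph) → ∀ {u v} → Adj G u v → Adj G v u
Adj-sym G {u} {v} = subst T (sym G u v)

module _ (G : WGraph) where

  walkLength-◅◅ : ∀ {u v w} (p : Path G u v) (q : Path G v w) →
                  walkLength G (p ◅◅ q) ≡ walkLength G p ℚ.+ walkLength G q
  walkLength-◅◅ [] q = ≡.sym (ℚ.+-identityˡ _)
  walkLength-◅◅ (_∷_ {u} {w} e p) q =
    trans (cong (len G u w ℚ.+_) (walkLength-◅◅ p q)) (≡.sym (ℚ.+-assoc (len G u w) _ _))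

  0≤walkLength : ∀ {u v} (p : Path G u v) → 0ℚ ℚ.≤ walkLength G p
  0≤walkLength [] = ℚ.≤-refl
  0≤walkLength (_∷_ {u} {w} e p) =
    subst (ℚ._≤ len G u w ℚ.+ walkLength G p) (ℚ.+-identityˡ 0ℚ) (ℚ.+-mono-≤ (lenNonneg G u w) (0≤walkLength p))

  integralLength : ∃[ k ] Σ[ L ∈ (Vertex G → Vertex G → ℕ) ]
                   ((∀ u v → len G u v ≡ L u v · unitFraction k) × (∀ u v → L u v ≡ L v u))
  integralLength = k , L , L-eq , λ u v → ℕ.⊓-comm (proj₁ (multiple u v)) (proj₁ (multiple v u))
    where
    lengthOf : Vertex G × Vertex G → ℚ
    lengthOf (u , v) = len G u v
    pairs = cartesianProduct (allFin (n (graph G))) (allFin (n (graph G)))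
    common = commonDenominator (map lengthOf pairs) (All.map⁺ (All.tabulate λ {(u , v)} _ → lenNonneg G u v))
    k = proj₁ common
    multiple : ∀ u v → ∃[ m ] (len G u v ≡ m · unitFraction k)
    multiple u v = All.lookup (proj₂ common) (∈-map⁺ lengthOf (∈-cartesianProduct⁺ (∈-allFin u) (∈-allFin v)))
    -- The multiples for (u, v) and (v, u) are chosen separately; taking their minimum makes `L`
    -- symmetric as a function to the naturals.
    L : Vertex G → Vertex G → ℕ
    L u v = proj₁ (multiple u v) ℕ.⊓ proj₁ (multiple v u)
    L-eq : ∀ u v → len G u v ≡ L u v · unitFraction k
    L-eq u v with ℕ.⊓-sel (proj₁ (multiple u v)) (proj₁ (multiple v u))
    ... | inj₁ eq = trans (proj₂ (multiple u v)) (cong (_· unitFraction k) (≡.sym eq))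
    ... | inj₂ eq = trans (lenSym G u v) (trans (proj₂ (multiple v u)) (cong (_· unitFraction k) (≡.sym eq)))

-- `d` is the perturbed integral distance and `ℓ` the original one. `linear` is the form in which
-- uniqueness of shortest paths is used: the vertices between `u` and `v` are ordered along one
-- path. Values on disconnected pairs are meaningless, which is why `Between` and `d-triangle` carry
-- walks.
record Geodesics (G : WGraph) : Set where
  field
    conn? : ∀ u v → Dec (Path G u v)
    d : Vertex G → Vertex G → ℕ
    d-refl : ∀ u → d u u ≡ 0
    d-sym : ∀ u v → d u v ≡ d v u
    d-triangle : ∀ {u x v} → Path G u x → Path G x v → d u v ≤ d u x + d x v
    d≡0 : ∀ {u v} → Path G u v → d u v ≡ 0 → u ≡ v

  Between : Vertex G → Vertex G → Vertex G → Set
  Between u x v = Path G u x × Path G x v × d u x + d x v ≡ d u v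

  field
    linear : ∀ {u v a b} → Between u a v → Between u b v → Between u b a ⊎ Between u a b
    step : ∀ {u v} → Path G u v → u ≢ v → ∃[ z ] (Adj (graph G) u z × Between u z v)
    ℓ : Vertex G → Vertex G → ℚ
    ℓ-sym : ∀ u v → ℓ u v ≡ ℓ v u
    0≤ℓ : ∀ u v → 0ℚ ℚ.≤ ℓ u v
    ℓ-walk : ∀ {u v} → Path G u v → Σ[ p ∈ Path G u v ] walkLength G p ≡ ℓ u v
    ℓ-min : ∀ {u v} (p : Path G u v) → ℓ u v ℚ.≤ walkLength G p
    ℓ-split : ∀ {u x v} → Between u x v → ℓ u x ℚ.+ ℓ x v ℚ.≤ ℓ u v

module UniqueShortestPaths (G : WGraph) (k : ℕ) (L : Vertex G → Vertex G → ℕ)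
  (L-eq : ∀ u v → len G u v ≡ L u v · unitFraction k) (L-sym : ∀ u v → L u v ≡ L v u) where

  opaque

    -- Exceeds twice the code of any repetition-free list, so the tie-breaking term of a simple walk
    -- stays below one unit of length.
    big : ℕ
    big = 2 * 2 ^ n (graph G)

    -- The length dominates lexicographically; the bits make the weight of a simple walk between
    -- given endpoints determine its vertex set, so that ties between shortest paths are broken
    -- symmetrically and consistently.
    W : Vertex G → Vertex G → ℕ
    W u v = L u v * big + (bit u + bit v)

    W>0 : ∀ u v → 0 < W u v
    W>0 u v = ℕ.≤-trans (bit>0 u) (ℕ.≤-trans (ℕ.m≤m+n (bit u) (bit v)) (ℕ.m≤n+m _ (L u v * big)))

    -- An inner vertex contributes its bit through two edges of the walk, an endpoint through only
    -- one; adding the bits of both endpoints makes every occurrence count twice.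
    weight-decompose : ∀ {u v} (p : Path G u v) →
                       weight W p + (bit u + bit v) ≡ weight L p * big + 2 * code (vertices p)
    weight-decompose {u} [] = ≡.sym (trans (cong (2 *_) (trans (code-∷ u []) (cong (bit u +_) (code-[] {n (graph G)})))) (lemma (bit u)))
      where
      lemma : ∀ a → 2 * (a + 0) ≡ a + a
      lemma = solve-∀
    weight-decompose {u} {v} (_∷_ {w = w} e p) = begin
      L u w * big + (bit u + bit w) + weight W p + (bit u + bit v)
        ≡⟨ lemma₁ (L u w * big) (bit u) (bit w) (weight W p) (bit v) ⟩
      L u w * big + 2 * bit u + (weight W p + (bit w + bit v))
        ≡⟨ cong (L u w * big + 2 * bit u +_) (weight-decompose p) ⟩
      L u w * big + 2 * bit u + (weight L p * big + 2 * code (vertices p))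
        ≡⟨ lemma₂ (L u w) big (bit u) (weight L p) (code (vertices p)) ⟩
      (L u w + weight L p) * big + 2 * (bit u + code (vertices p))
        ≡⟨ cong (λ c → (L u w + weight L p) * big + 2 * c) (code-∷ u (vertices p)) ⟨
      (L u w + weight L p) * big + 2 * code (u ∷ vertices p) ∎
      where
      open ≡.≡-Reasoning
      lemma₁ : ∀ a b c e f → a + (b + c) + e + (b + f) ≡ a + 2 * b + (e + (c + f))
      lemma₁ = solve-∀
      lemma₂ : ∀ a b c e f → a * b + 2 * c + (e * b + 2 * f) ≡ (a + e) * b + 2 * (c + f)
      lemma₂ = solve-∀

    W-sym : ∀ u v → W u v ≡ W v u
    W-sym u v = cong₂ _+_ (cong (_* big) (L-sym u v)) (ℕ.+-comm (bit u) (bit v))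

    2*code<big : {xs : List (Vertex G)} → Unique xs → 2 * code xs < big
    2*code<big uniq = ℕ.*-monoʳ-< 2 (binary< _ (count-Unique≤1 uniq))

  walkLength≡ : ∀ {u v} (p : Path G u v) → walkLength G p ≡ weight L p · unitFraction k
  walkLength≡ [] = refl
  walkLength≡ (_∷_ {u} {w} e p) =
    trans (cong₂ ℚ._+_ (L-eq u w) (walkLength≡ p)) (≡.sym (×-homo-+ (unitFraction k) (L u w) (weight L p)))

  Shortest : ∀ {u v} → Path G u v → Set
  Shortest {u} {v} p = ∀ (q : Path G u v) → weight W p ≤ weight W q

  -- The competitor is simplified first, since only a simple walk has a tie-breaking term below
  -- `big`; then a smaller perturbed weight cannot come with a larger length.
  shortest⇒weightL≤ : ∀ {u v} (p : Path G u v) → Shortest p → ∀ (q : Path G u v) → weight L p ≤ weight L q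
  shortest⇒weightL≤ {u} {v} p short q with simplify L q
  ... | q′ , uniq , q′≤q = ℕ.≤-trans (s≤s⁻¹ (ℕ.*-cancelʳ-< big _ _ (begin-strict
    weight L p * big ≤⟨ ℕ.m≤m+n _ _ ⟩
    weight L p * big + 2 * code (vertices p) ≡⟨ weight-decompose p ⟨
    weight W p + (bit u + bit v) ≤⟨ ℕ.+-monoˡ-≤ (bit u + bit v) (short q′) ⟩
    weight W q′ + (bit u + bit v) ≡⟨ weight-decompose q′ ⟩
    weight L q′ * big + 2 * code (vertices q′) <⟨ ℕ.+-monoʳ-< (weight L q′ * big) (2*code<big uniq) ⟩
    weight L q′ * big + big ≡⟨ ℕ.+-comm _ big ⟩
    suc (weight L q′) * big ∎))) q′≤q
    where open ℕ.≤-Reasoning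

  -- Returning to the start would leave a suffix that is lighter by at least the positive weight of
  -- the first edge.
  shortest⇒Unique : ∀ {u v} (p : Path G u v) → Shortest p → Unique (vertices p)
  shortest⇒Unique [] short = [] ∷ []
  shortest⇒Unique (_∷_ {u} {w} e p) short = All.¬Any⇒All¬ _ u∉p ∷ shortest⇒Unique p λ q → ℕ.+-cancelˡ-≤ (W u w) _ _ (short (e ∷ q))
    where
    u∉p : u ∉ vertices p
    u∉p u∈p with split W p u∈p
    ... | p₁ , p₂ , eq = ℕ.<⇒≱
      (ℕ.≤-<-trans (ℕ.≤-trans (ℕ.m≤n+m _ (weight W p₁)) (ℕ.≤-reflexive eq)) (ℕ.m<n+m (weight W p) (W>0 u w)))
      (short p₂)

  -- Equal perturbed weights and equal lengths leave equal codes. Agreement of vertex sets is all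
  -- that `linear` needs; the walks themselves are not compared.
  shortest⇒sameVertices : ∀ {u v} (p q : Path G u v) → Shortest p → Shortest q → ∀ {x} → x ∈ vertices p → x ∈ vertices q
  shortest⇒sameVertices {u} {v} p q short-p short-q =
    code-injective (shortest⇒Unique p short-p) (shortest⇒Unique q short-q)
      (ℕ.*-cancelˡ-≡ _ _ 2 (ℕ.+-cancelˡ-≡ (weight L p * big) _ _ (begin
        weight L p * big + 2 * code (vertices p) ≡⟨ weight-decompose p ⟨
        weight W p + (bit u + bit v) ≡⟨ cong (_+ (bit u + bit v)) (ℕ.≤-antisym (short-p q) (short-q p)) ⟩
        weight W q + (bit u + bit v) ≡⟨ weight-decompose q ⟩
        weight L q * big + 2 * code (vertices q)
          ≡⟨ cong (λ l → l * big + 2 * code (vertices q)) (ℕ.≤-antisym (shortest⇒weightL≤ q short-q p) (shortest⇒weightL≤ p short-p q)) ⟩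
        weight L p * big + 2 * code (vertices q) ∎)))
    where open ≡.≡-Reasoning

  conn? : ∀ u v → Dec (Path G u v)
  conn? = connected? (λ u v → T? (adj (graph G) u v))

  shortestPath : ∀ {u v} → Path G u v → Σ[ p ∈ Path G u v ] Shortest p
  shortestPath = lightestWalk (λ u v → T? (adj (graph G) u v)) W W>0

  E-sym : ∀ {u v} → Adj (graph G) u v → Adj (graph G) v u
  E-sym = Adj-sym (graph G)

  d : Vertex G → Vertex G → ℕ
  d u v with conn? u v
  ... | yes p = weight W (proj₁ (shortestPath p))
  ... | no _ = 0

  ℓ : Vertex G → Vertex G → ℚ
  ℓ u v with conn? u v
  ... | yes p = walkLength G (proj₁ (shortestPath p))
  ... | no _ = 0ℚ

  geodesic : ∀ {u v} → Path G u v → Σ[ p ∈ Path G u v ] (Shortest p × weight W p ≡ d u v × walkLength G p ≡ ℓ u v)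
  geodesic {u} {v} p with conn? u v
  ... | yes q = proj₁ (shortestPath q) , proj₂ (shortestPath q) , refl , refl
  ... | no ¬p = contradiction p ¬p

  d-min : ∀ {u v} (p : Path G u v) → d u v ≤ weight W p
  d-min p = let _ , short , eq , _ = geodesic p in subst (_≤ weight W p) eq (short p)

  weight≡d⇒Shortest : ∀ {u v} (p : Path G u v) → weight W p ≡ d u v → Shortest p
  weight≡d⇒Shortest p eq q = subst (_≤ _) (≡.sym eq) (d-min q)

  shortest⇒walkLength≤ : ∀ {u v} (p : Path G u v) → Shortest p → ∀ (q : Path G u v) → walkLength G p ℚ.≤ walkLength G q
  shortest⇒walkLength≤ p short q = ≡.subst₂ ℚ._≤_ (≡.sym (walkLength≡ p)) (≡.sym (walkLength≡ q))
    (·-mono-≤ (0≤unitFraction k) (shortest⇒weightL≤ p short q))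

  ℓ-min : ∀ {u v} (p : Path G u v) → ℓ u v ℚ.≤ walkLength G p
  ℓ-min p = let q , short , _ , eq = geodesic p in subst (ℚ._≤ _) eq (shortest⇒walkLength≤ q short p)

  d-triangle : ∀ {u x v} → Path G u x → Path G x v → d u v ≤ d u x + d x v
  d-triangle p q with geodesic p | geodesic q
  ... | p′ , _ , eq-p , _ | q′ , _ , eq-q , _ =
    subst (_ ≤_) (trans (weight-◅◅ W p′ q′) (cong₂ _+_ eq-p eq-q)) (d-min (p′ ◅◅ q′))

  d-sym : ∀ u v → d u v ≡ d v u
  d-sym u v = case conn? u v of λ where
      (yes p) → ℕ.≤-antisym (half (reverse E-sym p)) (half p)
      (no ¬p) → trans (d-junk ¬p) (≡.sym (d-junk (¬p ∘ reverse E-sym)))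
    where
    d-junk : ∀ {u v} → ¬ Path G u v → d u v ≡ 0
    d-junk {u} {v} ¬p with conn? u v
    ... | yes p = contradiction p ¬p
    ... | no _ = refl
    half : ∀ {u v} → Path G u v → d v u ≤ d u v
    half p with geodesic p
    ... | q , _ , eq , _ = subst (_ ≤_) (trans (weight-reverse W E-sym W-sym q) eq) (d-min (reverse E-sym q))

  walkLength-reverse : ∀ {u v} (p : Path G u v) → walkLength G (reverse E-sym p) ≡ walkLength G p
  walkLength-reverse p = trans (walkLength≡ (reverse E-sym p))
    (trans (cong (_· unitFraction k) (weight-reverse L E-sym L-sym p)) (≡.sym (walkLength≡ p)))

  ℓ-junk : ∀ {u v} → ¬ Path G u v → ℓ u v ≡ 0ℚ
  ℓ-junk {u} {v} ¬p with conn? u v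
  ... | yes p = contradiction p ¬p
  ... | no _ = refl

  ℓ-sym : ∀ u v → ℓ u v ≡ ℓ v u
  ℓ-sym u v = case conn? u v of λ where
      (yes p) → ℚ.≤-antisym (half (reverse E-sym p)) (half p)
      (no ¬p) → trans (ℓ-junk ¬p) (≡.sym (ℓ-junk (¬p ∘ reverse E-sym)))
    where
    half : ∀ {u v} → Path G u v → ℓ v u ℚ.≤ ℓ u v
    half p with geodesic p
    ... | q , _ , _ , eq = subst (_ ℚ.≤_) (trans (walkLength-reverse q) eq) (ℓ-min (reverse E-sym q))

  0≤ℓ : ∀ u v → 0ℚ ℚ.≤ ℓ u v
  0≤ℓ u v = case conn? u v of λ where
    (yes p) → let q , _ , _ , eq = geodesic p in subst (0ℚ ℚ.≤_) eq (0≤walkLength G q)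
    (no ¬p) → ℚ.≤-reflexive (≡.sym (ℓ-junk ¬p))

  d≡0 : ∀ {u v} → Path G u v → d u v ≡ 0 → u ≡ v
  d≡0 p d≡0 with geodesic p
  ... | [] , _ = refl
  ... | (_∷_ {u} {w} e q) , _ , eq , _ =
    contradiction (ℕ.m+n≡0⇒m≡0 (W u w) (trans eq d≡0)) (ℕ.>⇒≢ (W>0 u w))

  Between : Vertex G → Vertex G → Vertex G → Set
  Between u x v = Path G u x × Path G x v × d u x + d x v ≡ d u v

  pathVia : ∀ {u x v} → Between u x v →
            Σ[ p ∈ Path G u x ] Σ[ q ∈ Path G x v ]
            (Shortest (p ◅◅ q) × weight W p ≡ d u x × weight W q ≡ d x v × walkLength G p ≡ ℓ u x × walkLength G q ≡ ℓ x v)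
  pathVia (p₀ , q₀ , eq) with geodesic p₀ | geodesic q₀
  ... | p , _ , eq-p , ℓ-p | q , _ , eq-q , ℓ-q =
    p , q , weight≡d⇒Shortest (p ◅◅ q) (trans (weight-◅◅ W p q) (trans (cong₂ _+_ eq-p eq-q) eq)) , eq-p , eq-q , ℓ-p , ℓ-q

  ∈geodesic⇒Between : ∀ {u v x} (p : Path G u v) → weight W p ≡ d u v → x ∈ vertices p → Between u x v
  ∈geodesic⇒Between {u} {v} {x} p eq x∈p with split W p x∈p
  ... | p₁ , p₂ , eq′ = p₁ , p₂ , ℕ.≤-antisym
    (subst (d u x + d x v ≤_) (trans eq′ eq) (ℕ.+-mono-≤ (d-min p₁) (d-min p₂))) (d-triangle p₁ p₂)

  -- Shortest walks through `a` and through `b` have the same vertices, so `b` occurs on the walk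
  -- through `a`, in the half before `a` or in the half after it.
  linear : ∀ {u v a b} → Between u a v → Between u b v → Between u b a ⊎ Between u a b
  linear {u} {v} {a} {b} via-a via-b@(p-ub , _ , eq-b) with pathVia via-a | pathVia via-b
  ... | p , q , short , eq-p , eq-q , _ | p′ , q′ , short′ , _
    with ∈-vertices-◅◅ p q (shortest⇒sameVertices (p′ ◅◅ q′) (p ◅◅ q) short′ short (middle∈vertices p′ q′))
  ... | inj₁ b∈p = inj₁ (∈geodesic⇒Between p eq-p b∈p)
  ... | inj₂ b∈q with ∈geodesic⇒Between q eq-q b∈q
  ...   | p-ab , p-bv , eq-ab = inj₂ (p , p-ab , ℕ.+-cancelʳ-≡ (d b v) _ _ (begin
    d u a + d a b + d b v ≡⟨ ℕ.+-assoc (d u a) _ _ ⟩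
    d u a + (d a b + d b v) ≡⟨ cong (d u a +_) eq-ab ⟩
    d u a + d a v ≡⟨ proj₂ (proj₂ via-a) ⟩
    d u v ≡⟨ eq-b ⟨
    d u b + d b v ∎))
    where open ≡.≡-Reasoning

  step : ∀ {u v} → Path G u v → u ≢ v → ∃[ z ] (Adj (graph G) u z × Between u z v)
  step p u≢v with geodesic p
  ... | [] , _ = contradiction refl u≢v
  ... | (e ∷ q) , _ , eq , _ = _ , e , ∈geodesic⇒Between (e ∷ q) eq (there (start∈vertices q))

  -- A concatenation that is shortest for the perturbed weight is also shortest for the original
  -- length.
  ℓ-split : ∀ {u x v} → Between u x v → ℓ u x ℚ.+ ℓ x v ℚ.≤ ℓ u v
  ℓ-split {u} {x} {v} btw@(p₀ , q₀ , _) with pathVia btw | geodesic (p₀ ◅◅ q₀)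
  ... | p , q , short , _ , _ , ℓ-p , ℓ-q | r , _ , _ , ℓ-r =
    ≡.subst₂ ℚ._≤_ (trans (walkLength-◅◅ G p q) (cong₂ ℚ._+_ ℓ-p ℓ-q)) ℓ-r (shortest⇒walkLength≤ (p ◅◅ q) short r)

  geodesics : Geodesics G
  geodesics = record
    { conn? = conn? ; d = d ; d-refl = λ u → ℕ.n≤0⇒n≡0 (d-min {u} []) ; d-sym = d-sym
    ; d-triangle = d-triangle ; d≡0 = d≡0 ; linear = linear ; step = step
    ; ℓ = ℓ ; ℓ-sym = ℓ-sym ; 0≤ℓ = 0≤ℓ
    ; ℓ-walk = λ p → let q , _ , _ , eq = geodesic p in q , eq
    ; ℓ-min = ℓ-min ; ℓ-split = ℓ-split }

opaque
  geodesics : ∀ G → Geodesics G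
  geodesics G = let k , L , L-eq , L-sym = integralLength G in UniqueShortestPaths.geodesics G k L L-eq L-sym

-- The minor determined by a family of regions

∑ : ∀ {r} → (Fin r → ℕ) → ℕ
∑ {zero} f = 0
∑ {suc r} f = f Fin.zero + ∑ (f ∘ Fin.suc)

-- `unique` gives every vertex outside `portals` a single region; this is what keeps the geodesics
-- of different regions apart.
record Regions (G : WGraph) : Set where
  field
    r : ℕ
    region boundary : Fin r → List (Vertex G)
    portals : List (Vertex G)
    coverVertex : ∀ v → ∃[ i ] v ∈ region i
    coverEdge : ∀ {u v} → Adj (graph G) u v → ∃[ i ] (u ∈ region i × v ∈ region i)
    unique : ∀ {v i j} → v ∉ portals → v ∈ region i → v ∈ region j → i ≡ j
    portal∈boundary : ∀ {v i} → v ∈ portals → v ∈ region i → v ∈ boundary i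

  cost : ℕ
  cost = ∑ λ i → length (boundary i) ^ 4

-- Betweenness in the perturbed metric.

module Intervals {G : WGraph} (geo : Geodesics G) where

  open Geodesics geo

  private V = Vertex G

  path-sym : ∀ {u v} → Path G u v → Path G v u
  path-sym = reverse (Adj-sym (graph G))

  between? : ∀ u x v → Dec (Between u x v)
  between? u x v = conn? u x ×-dec conn? x v ×-dec (d u x + d x v ℕ.≟ d u v)

  between-sym : ∀ {u x v} → Between u x v → Between v x u
  between-sym {u} {x} {v} (p , q , eq) = path-sym q , path-sym p , (begin
    d v x + d x u ≡⟨ cong₂ _+_ (d-sym v x) (d-sym x u) ⟩
    d x v + d u x ≡⟨ ℕ.+-comm (d x v) (d u x) ⟩
    d u x + d x v ≡⟨ eq ⟩
    d u v ≡⟨ d-sym u v ⟩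
    d v u ∎)
    where open ≡.≡-Reasoning

  between-left : ∀ {u v} → Path G u v → Between u u v
  between-left {u} {v} p = [] , p , cong (_+ d u v) (d-refl u)

  between-right : ∀ {u v} → Path G u v → Between u v v
  between-right p = between-sym (between-left (path-sym p))

  -- The three distances along u, x, a, v add up to `d u v`, so both triangle inequalities involved
  -- are equalities.
  nested-left : ∀ {u x a v} → Between u a v → Between u x a → Between u x v × Between x a v
  nested-left {u} {x} {a} {v} (_ , q , eq) (p , p′ , eq′) =
    (p , p′ ◅◅ q , u-x-v) , (p′ , q , ℕ.+-cancelˡ-≡ (d u x) _ _ (trans sum (≡.sym u-x-v)))
    where
    sum : d u x + (d x a + d a v) ≡ d u v
    sum = trans (≡.sym (ℕ.+-assoc (d u x) _ _)) (trans (cong (_+ d a v) eq′) eq)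
    u-x-v : d u x + d x v ≡ d u v
    u-x-v = ℕ.≤-antisym (ℕ.≤-trans (ℕ.+-monoʳ-≤ (d u x) (d-triangle p′ q)) (ℕ.≤-reflexive sum))
                        (d-triangle p (p′ ◅◅ q))

  nested-right : ∀ {u x a v} → Between u x v → Between x a v → Between u a v × Between u x a
  nested-right b b′ with nested-left (between-sym b) (between-sym b′)
  ... | c , c′ = between-sym c , between-sym c′

  nested-mid : ∀ {u a x b v} → Between u a v → Between a b v → Between a x b → Between u x v
  nested-mid b b′ b″ = proj₁ (nested-right b (proj₁ (nested-left b′ b″)))

  between≤⇒≡ : ∀ {u a b} → Between u a b → d u b ≤ d u a → a ≡ b
  between≤⇒≡ {u} {a} {b} (_ , q , eq) b≤a = d≡0 q (ℕ.n≤0⇒n≡0 (ℕ.+-cancelˡ-≤ (d u a) _ _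
    (ℕ.≤-trans (ℕ.≤-reflexive eq) (ℕ.≤-trans b≤a (ℕ.≤-reflexive (≡.sym (ℕ.+-identityʳ (d u a))))))))

  between-≤ : ∀ {u a b} → Between u a b → d u a ≤ d u b
  between-≤ (_ , _ , eq) = ℕ.≤-trans (ℕ.m≤m+n _ _) (ℕ.≤-reflexive eq)

  between-antisym : ∀ {u a b} → Between u a b → Between u b a → a ≡ b
  between-antisym b b′ = between≤⇒≡ b (between-≤ b′)

  between-loop : ∀ {u x} → Between u x u → x ≡ u
  between-loop {u} b = between≤⇒≡ b (ℕ.≤-trans (ℕ.≤-reflexive (d-refl u)) z≤n)

  between-< : ∀ {u x v} → Between u x v → x ≢ v → d u x < d u v
  between-< b x≢v = ℕ.≰⇒> (x≢v ∘ between≤⇒≡ b)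

  between-<′ : ∀ {u x v} → Between u x v → x ≢ u → d x v < d u v
  between-<′ {u} {x} {v} b x≢u = ≡.subst₂ _<_ (d-sym v x) (d-sym v u) (between-< (between-sym b) x≢u)

  Common : V → V → V → V → V → Set
  Common u v u′ v′ w = Between u w v × Between u′ w v′

  common? : ∀ u v u′ v′ w → Dec (Common u v u′ v′ w)
  common? u v u′ v′ w = between? u w v ×-dec between? u′ w v′

  -- Junk if [u,v] and [u′,v′] are disjoint.
  opaque
    firstCommon : ∀ u v u′ v′ → ∃[ c ] (∀ w → Common u v u′ v′ w → Common u v u′ v′ c × d u c ≤ d u w)
    firstCommon u v u′ v′ with Fin.any? (common? u v u′ v′)
    ... | no none = u , λ w cw → contradiction (w , cw) none
    ... | yes (w₀ , cw₀) = argmin (d u) w₀ ws , λ w cw →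
        argmin-all (d u) cw₀ (All.all-filter (common? u v u′ v′) (allFin _)) ,
        All.lookup (f[argmin]≤f[xs] w₀ ws) (∈-filter⁺ (common? u v u′ v′) (∈-allFin w) cw)
      where
      ws : List V
      ws = filter (common? u v u′ v′) (allFin _)

  -- By `linear`, `c` and `w` are ordered along the geodesic from `u`; if `w` came first, minimality
  -- of `d u c` would make them equal.
  firstCommon-before : ∀ {u v u′ v′ w} → Common u v u′ v′ w →
    let c = proj₁ (firstCommon u v u′ v′) in Between u c w × Between u′ c v′
  firstCommon-before {u} {v} {u′} {v′} {w} cw@(b , _) with firstCommon u v u′ v′
  ... | c , spec with spec w cw
  ...   | (b-c , b′-c) , c≤w with linear b-c b
  ...     | inj₂ u-c-w = u-c-w , b′-c
  ...     | inj₁ u-w-c = subst (λ z → Between u z w) (between≤⇒≡ u-w-c c≤w) (between-right (proj₁ u-w-c)) , b′-c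

-- Kept vertices, segments and branch sets.

length-cartesianProduct : ∀ {A B : Set} (xs : List A) (ys : List B) →
                          length (cartesianProduct xs ys) ≡ length xs * length ys
length-cartesianProduct [] ys = refl
length-cartesianProduct (x ∷ xs) ys = trans (length-++ (map (x ,_) ys))
  (cong₂ _+_ (length-map (x ,_) ys) (length-cartesianProduct xs ys))

length-concat : ∀ {A : Set} {r} (f : Fin r → List A) (g : Fin r → ℕ) → (∀ i → length (f i) ≡ g i) →
                length (concat (tabulate f)) ≡ ∑ g
length-concat {r = zero} f g eq = refl
length-concat {r = suc r} f g eq = trans (length-++ (f Fin.zero))
  (cong₂ _+_ (eq Fin.zero) (length-concat (f ∘ Fin.suc) (g ∘ Fin.suc) (eq ∘ Fin.suc)))

module RegionMinor {G : WGraph} (geo : Geodesics G) (R : Regions G) where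

  open Geodesics geo
  open Intervals geo
  open Regions R

  private V = Vertex G

  open DecMembership (Fin._≟_ {n (graph G)}) using (_∈?_)

  Pair : Set
  Pair = V × V

  first : Pair × Pair → V
  first ((u , v) , (u′ , v′)) = proj₁ (firstCommon u v u′ v′)

  -- The pairs are ordered: exchanging `u` and `v` turns the first common vertex into the last one,
  -- so both ends of every overlap are listed.
  branchPoints : List V → List V
  branchPoints b = map first (cartesianProduct (cartesianProduct b b) (cartesianProduct b b))

  length-branchPoints : ∀ b → length (branchPoints b) ≡ length b ^ 4
  length-branchPoints b = begin
    length (branchPoints b) ≡⟨ length-map first (cartesianProduct (cartesianProduct b b) (cartesianProduct b b)) ⟩
    length (cartesianProduct (cartesianProduct b b) (cartesianProduct b b))
      ≡⟨ length-cartesianProduct (cartesianProduct b b) (cartesianProduct b b) ⟩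
    length (cartesianProduct b b) * length (cartesianProduct b b)
      ≡⟨ cong (λ m → m * m) (length-cartesianProduct b b) ⟩
    length b * length b * (length b * length b) ≡⟨ fourth (length b) ⟩
    length b ^ 4 ∎
    where
    open ≡.≡-Reasoning
    fourth : ∀ a → a * a * (a * a) ≡ a * (a * (a * (a * 1)))
    fourth = solve-∀

  opaque
    kept : List V
    kept = deduplicate Fin._≟_ (concat (tabulate (branchPoints ∘ boundary)))

    kept-Unique : Unique kept
    kept-Unique = deduplicate-! Fin._≟_ _

    firstCommon∈kept : ∀ {i u v u′ v′} → u ∈ boundary i → v ∈ boundary i → u′ ∈ boundary i → v′ ∈ boundary i →
                       proj₁ (firstCommon u v u′ v′) ∈ kept
    firstCommon∈kept {i} u∈ v∈ u′∈ v′∈ = ∈-deduplicate⁺ Fin._≟_ (∈-concat⁺′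
      (∈-map⁺ first (∈-cartesianProduct⁺ (∈-cartesianProduct⁺ u∈ v∈) (∈-cartesianProduct⁺ u′∈ v′∈)))
      (∈-tabulate⁺ i))

    length-kept : length kept ≤ cost
    length-kept = ℕ.≤-trans (length-deduplicate Fin._≟_ (concat (tabulate (branchPoints ∘ boundary))))
      (ℕ.≤-reflexive (length-concat (branchPoints ∘ boundary) (λ i → length (boundary i) ^ 4) (length-branchPoints ∘ boundary)))

  V′ : Set
  V′ = Fin (length kept)

  κ : V′ → V
  κ = lookup kept

  κ-injective : ∀ {x y} → κ x ≡ κ y → x ≡ y
  κ-injective {x} {y} = lookup-injective kept-Unique x y

  Kept : V → Set
  Kept v = ∃[ x ] v ≡ κ x

  kept? : ∀ v → Dec (Kept v)
  kept? v = Fin.any? (λ x → v Fin.≟ κ x)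

  κ-Kept : ∀ x → Kept (κ x)
  κ-Kept x = x , refl

  branchPoint-Kept : ∀ {i u v u′ v′} → u ∈ boundary i → v ∈ boundary i → u′ ∈ boundary i → v′ ∈ boundary i →
                     Kept (proj₁ (firstCommon u v u′ v′))
  branchPoint-Kept u∈ v∈ u′∈ v′∈ = let c∈ = firstCommon∈kept u∈ v∈ u′∈ v′∈ in index c∈ , lookup-index c∈

  -- The degenerate geodesic from `u` to `u` meets itself first in `u`.
  boundary-Kept : ∀ {i u} → u ∈ boundary i → Kept u
  boundary-Kept {i} {u} u∈ = subst Kept (between-loop (proj₁ (firstCommon-before loop))) (branchPoint-Kept u∈ u∈ u∈ u∈)
    where
    loop : Common u u u u u
    loop = between-left [] , between-left []

  portal-Kept : ∀ {v} → v ∈ portals → Kept v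
  portal-Kept {v} v∈ = let i , v∈i = coverVertex v in boundary-Kept (portal∈boundary v∈ v∈i)

  -- These are the pieces into which portals cut the shortest paths between terminals.
  record Good (i : Fin r) (u v : V) : Set where
    constructor good
    field
      start : u ∈ boundary i
      end : v ∈ boundary i
      interior : ∀ w → Between u w v → w ≢ u → w ≢ v → w ∈ region i × w ∉ portals

  good? : ∀ i u v → Dec (Good i u v)
  good? i u v = map′ (λ (a , b , c) → good a b c) (λ (good a b c) → a , b , c)
    (u ∈? boundary i ×-dec v ∈? boundary i ×-dec
     Fin.all? λ w → between? u w v →-dec ¬? (w Fin.≟ u) →-dec ¬? (w Fin.≟ v) →-dec w ∈? region i ×-dec ¬? (w ∈? portals))

  good-sym : ∀ {i u v} → Good i u v → Good i v u
  good-sym (good s e int) = good e s λ w b w≢v w≢u → int w (between-sym b) w≢u w≢v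

  Consecutive : V′ → V′ → Set
  Consecutive x y = ∀ z → Between (κ x) (κ z) (κ y) → z ≡ x ⊎ z ≡ y

  -- Encodes the order u, `κ x`, `κ y`, v along the geodesic.
  On : V → V → V′ → V′ → Set
  On u v x y = Between u (κ x) v × Between (κ x) (κ y) v

  Segment : V′ → V′ → Set
  Segment x y = x ≢ y × Consecutive x y × ∃[ i ] ∃[ u ] ∃[ v ] (Good i u v × On u v x y)

  opaque
    segment? : ∀ x y → Dec (Segment x y)
    segment? x y = ¬? (x Fin.≟ y)
      ×-dec Fin.all? (λ z → between? (κ x) (κ z) (κ y) →-dec (z Fin.≟ x ⊎-dec z Fin.≟ y))
      ×-dec Fin.any? (λ i → Fin.any? λ u → Fin.any? λ v → good? i u v ×-dec between? u (κ x) v ×-dec between? (κ x) (κ y) v)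

  consecutive-sym : ∀ {x y} → Consecutive x y → Consecutive y x
  consecutive-sym cons z b with cons z (between-sym b)
  ... | inj₁ z≡x = inj₂ z≡x
  ... | inj₂ z≡y = inj₁ z≡y

  segment-sym : ∀ {x y} → Segment x y → Segment y x
  segment-sym (x≢y , cons , i , u , v , g , b , b′) with nested-right b b′
  ... | c , c′ = x≢y ∘ ≡.sym , consecutive-sym cons , i , v , u , good-sym g , between-sym c , between-sym c′

  consecutive-inside : ∀ {x y z w} → ¬ Kept w → Between (κ x) w (κ y) → Consecutive x y → Between (κ x) (κ z) w → z ≡ x
  consecutive-inside {x} {y} {z} {w} w∉ b cons b′ with cons z (proj₁ (nested-left b b′))
  ... | inj₁ z≡x = z≡x
  ... | inj₂ refl = contradiction (subst Kept (between-antisym b′ b) (κ-Kept y)) w∉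

  -- Seen from `u`, `κ x` is the last kept vertex before `w`: a later one would lie strictly inside
  -- the segment, contradicting `Consecutive`.
  before : ∀ {u x y a w} → ¬ Kept w → Between (κ x) w (κ y) → Consecutive x y →
           Between u (κ a) w → Between u (κ x) w → Between (κ a) (κ x) w
  before {u} {x} {y} {a} w∉ b cons u-a-w u-x-w with linear u-a-w u-x-w
  ... | inj₂ u-a-x = proj₂ (nested-left u-x-w u-a-x)
  ... | inj₁ u-x-a with consecutive-inside w∉ b cons (proj₂ (nested-left u-a-w u-x-a))
  ...   | refl = between-left (proj₁ (proj₂ u-a-w))

  -- Both `κ x` and `κ x′` are the last kept vertex before `w` as seen from `u`.
  same-side : ∀ {u x y x′ y′ w} → ¬ Kept w → Between (κ x) w (κ y) → Consecutive x y →
              Between (κ x′) w (κ y′) → Consecutive x′ y′ → Between u (κ x) w → Between u (κ x′) w → x ≡ x′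
  same-side w∉ b cons b′ cons′ u-x-w u-x′-w = κ-injective (between-antisym
    (between-sym (before w∉ b cons u-x′-w u-x-w)) (between-sym (before w∉ b′ cons′ u-x-w u-x′-w)))

  between-hull : ∀ {u v a b x} → Between u a v → Between u b v → Between a x b → Between u x v
  between-hull u-a-v u-b-v a-x-b with linear u-a-v u-b-v
  ... | inj₂ u-a-b = nested-mid u-a-v (proj₂ (nested-left u-b-v u-a-b)) a-x-b
  ... | inj₁ u-b-a = nested-mid u-b-v (proj₂ (nested-left u-a-v u-b-a)) (between-sym a-x-b)

  on-geodesic : ∀ {u v x y w} → On u v x y → Between (κ x) w (κ y) → Between u (κ x) w × Between v (κ y) w × Between u w v
  on-geodesic (b , b′) x-w-y with nested-right b b′
  ... | u-y-v , u-x-y =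
    let u-w-y , u-x-w = nested-right u-x-y x-w-y
        x-w-v , w-y-v = nested-left b′ x-w-y
    in u-x-w , between-sym w-y-v , nested-mid b b′ x-w-y

  good-region : ∀ {i u v w} → Good i u v → ¬ Kept w → Between u w v → w ∈ region i × w ∉ portals
  good-region g w∉ b = Good.interior g _ b
    (λ { refl → w∉ (boundary-Kept (Good.start g)) }) (λ { refl → w∉ (boundary-Kept (Good.end g)) })

  -- If a good geodesic [u′,v′] meets the interior of a segment cut out by [u,v], then that segment
  -- lies between the first and the last common point of the two geodesics, which are both kept.
  segment⊆geodesic : ∀ {x y w j u′ v′} → Segment x y → ¬ Kept w → Between (κ x) w (κ y) →
                     Good j u′ v′ → Between u′ w v′ → Between u′ (κ x) v′ × Between u′ (κ y) v′
  segment⊆geodesic {x} {y} {w} {j} {u′} {v′} (_ , cons , i , u , v , g , on) w∉ x-w-y g′ u′-w-v′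
    with on-geodesic on x-w-y
  ... | u-x-w , v-y-w , u-w-v with unique (proj₂ (good-region g w∉ u-w-v)) (proj₁ (good-region g w∉ u-w-v)) (proj₁ (good-region g′ w∉ u′-w-v′))
  ...   | refl
    with branchPoint-Kept (Good.start g) (Good.end g) (Good.start g′) (Good.end g′)
       | firstCommon-before (u-w-v , u′-w-v′)
       | branchPoint-Kept (Good.end g) (Good.start g) (Good.start g′) (Good.end g′)
       | firstCommon-before (between-sym u-w-v , u′-w-v′)
  ... | a , a≡ | u-a-w , u′-a-v′ | b , b≡ | v-b-w , u′-b-v′ rewrite a≡ | b≡ =
    between-hull u′-a-v′ u′-b-v′ (proj₁ (nested-left a-w-b a-x-w)) ,
    between-hull u′-b-v′ u′-a-v′ (proj₁ (nested-left (between-sym a-w-b) b-y-w))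
    where
    a-x-w : Between (κ a) (κ x) w
    a-x-w = before w∉ x-w-y cons u-a-w u-x-w
    b-y-w : Between (κ b) (κ y) w
    b-y-w = before w∉ (between-sym x-w-y) (consecutive-sym cons) v-b-w v-y-w
    a-w-b : Between (κ a) w (κ b)
    a-w-b = proj₂ (nested-right (proj₂ (nested-left u-w-v u-a-w)) (between-sym v-b-w))

  side : ∀ {u v x w} → Between u (κ x) v → Between u w v → Between u (κ x) w ⊎ Between v (κ x) w
  side u-x-v u-w-v with linear u-w-v u-x-v
  ... | inj₁ u-x-w = inj₁ u-x-w
  ... | inj₂ u-w-x = inj₂ (between-sym (proj₂ (nested-left u-x-v u-w-x)))

  -- The first segment lies on the geodesic that carries the second, so its ends can be sorted by
  -- the side of `w` they are on. Ends on the same side coincide, which matches the two segments up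
  -- to orientation and rules out both ends of one being on one side.
  segment-unique : ∀ {x y x′ y′ w} → Segment x y → Segment x′ y′ → ¬ Kept w →
                   Between (κ x) w (κ y) → Between (κ x′) w (κ y′) → (x ≡ x′ × y ≡ y′) ⊎ (x ≡ y′ × y ≡ x′)
  segment-unique {x} {y} {x′} {y′} {w} seg@(x≢y , cons , _) (_ , cons′ , j , u , v , g , on) w∉ b b′
    with on-geodesic on b′
  ... | u-x′-w , v-y′-w , u-w-v with segment⊆geodesic seg w∉ b g u-w-v
  ...   | u-x-v , u-y-v with side u-x-v u-w-v | side u-y-v u-w-v
  ...     | inj₁ u-x-w | inj₂ v-y-w = inj₁ (same-side w∉ b cons b′ cons′ u-x-w u-x′-w ,
    same-side w∉ (between-sym b) (consecutive-sym cons) (between-sym b′) (consecutive-sym cons′) v-y-w v-y′-w)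
  ...     | inj₂ v-x-w | inj₁ u-y-w = inj₂ (
    same-side w∉ b cons (between-sym b′) (consecutive-sym cons′) v-x-w v-y′-w ,
    same-side w∉ (between-sym b) (consecutive-sym cons) b′ cons′ u-y-w u-x′-w)
  ...     | inj₁ u-x-w | inj₁ u-y-w = contradiction (same-side w∉ b cons (between-sym b) (consecutive-sym cons) u-x-w u-y-w) x≢y
  ...     | inj₂ v-x-w | inj₂ v-y-w = contradiction (same-side w∉ b cons (between-sym b) (consecutive-sym cons) v-x-w v-y-w) x≢y

  -- The interior of a segment is contracted into the endpoint of smaller index.
  InBranch : V′ → V → Set
  InBranch x w = w ≡ κ x ⊎ ¬ Kept w × ∃[ y ] (x Fin.< y × Segment x y × Between (κ x) w (κ y))

  inBranch? : ∀ x w → Dec (InBranch x w)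
  inBranch? x w = w Fin.≟ κ x ⊎-dec ¬? (kept? w) ×-dec
    Fin.any? λ y → x Fin.<? y ×-dec segment? x y ×-dec between? (κ x) w (κ y)

  branch-unique : ∀ {x x′ w} → InBranch x w → InBranch x′ w → x ≡ x′
  branch-unique (inj₁ refl) (inj₁ eq) = κ-injective eq
  branch-unique (inj₁ refl) (inj₂ (w∉ , _)) = contradiction (κ-Kept _) w∉
  branch-unique (inj₂ (w∉ , _)) (inj₁ refl) = contradiction (κ-Kept _) w∉
  branch-unique (inj₂ (w∉ , _ , x<y , seg , b)) (inj₂ (_ , _ , x′<y′ , seg′ , b′)) with segment-unique seg seg′ w∉ b b′
  ... | inj₁ (x≡x′ , _) = x≡x′
  ... | inj₂ (refl , refl) = contradiction x<y (ℕ.<-asym x′<y′)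

  minor : WGraph
  minor = record
    { graph = record
      { n = length kept
      ; adj = λ x y → does (segment? x y)
      ; sym = λ x y → does-⇔ (mk⇔ segment-sym segment-sym) (segment? x y) (segment? y x)
      ; irr = λ x → dec-false (segment? x x) λ (x≢x , _) → x≢x refl }
    ; len = λ x y → ℓ (κ x) (κ y)
    ; lenSym = λ x y → ℓ-sym (κ x) (κ y)
    ; lenNonneg = λ x y → 0≤ℓ (κ x) (κ y) }

  segment : ∀ {x y} → Adj (graph minor) x y → Segment x y
  segment {x} {y} e with segment? x y
  ... | yes s = s

  edge : ∀ {x y} → Segment x y → Adj (graph minor) x y
  edge {x} {y} s = subst T (≡.sym (dec-true (segment? x y) s)) _

  φ : V → Maybe V′
  φ w with Fin.any? (λ x → inBranch? x w)
  ... | yes (x , _) = just x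
  ... | no _ = nothing

  φ-sound : ∀ {x w} → φ w ≡ just x → InBranch x w
  φ-sound {x} {w} eq with Fin.any? (λ x → inBranch? x w)
  φ-sound refl | yes (_ , b) = b

  φ-complete : ∀ {x w} → InBranch x w → φ w ≡ just x
  φ-complete {x} {w} b with Fin.any? (λ x → inBranch? x w)
  ... | yes (x′ , b′) = cong just (branch-unique b′ b)
  ... | no none = contradiction (x , b) none

  Adj⇒≢ : ∀ {u v} → Adj (graph G) u v → v ≢ u
  Adj⇒≢ {u} e refl = subst T (irr (graph G) u) e

  segment-inBranch : ∀ {x y z} → x Fin.< y → Segment x y → Between (κ x) z (κ y) → z ≢ κ y → InBranch x z
  segment-inBranch {z = z} x<y seg@(_ , cons , _) b z≢y with kept? z
  ... | no z∉ = inj₂ (z∉ , _ , x<y , seg , b)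
  ... | yes (a , refl) with cons a b
  ...   | inj₁ refl = inj₁ refl
  ...   | inj₂ refl = contradiction refl z≢y

  -- Following the geodesic from `w` towards `κ x` never leaves the segment, and the distance to
  -- `κ x` drops at every step.
  pathToCentre : ∀ {x w} → InBranch x w → Σ[ p ∈ Path G w (κ x) ] AllOn (λ v → φ v ≡ just x) p
  pathToCentre {x} {w} = descend (<-wellFounded (d w (κ x)))
    where
    descend : ∀ {w} → Acc _<_ (d w (κ x)) → InBranch x w → Σ[ p ∈ Path G w (κ x) ] AllOn (λ v → φ v ≡ just x) p
    descend _ (inj₁ refl) = [] , φ-complete (inj₁ refl)
    descend {w} (acc rec) br@(inj₂ (w∉ , y , x<y , seg , b)) with step (path-sym (proj₁ b)) (λ { refl → w∉ (κ-Kept x) })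
    ... | z , e , w-z-x with nested-left b (between-sym w-z-x)
    ...   | x-z-y , z-w-y with descend (rec (between-<′ w-z-x (Adj⇒≢ e))) (segment-inBranch x<y seg x-z-y
              λ { refl → w∉ (subst Kept (≡.sym (between-loop z-w-y)) (κ-Kept y)) })
    ...     | p , on = e ∷ p , φ-complete br , on

  -- The whole interior belongs to the branch set of `x`, so the last edge of the geodesic into
  -- `κ y` joins the two branch sets.
  edgeBetweenBranches : ∀ {x y} → x Fin.< y → Segment x y → ∃[ u ] (InBranch x u × Adj (graph G) u (κ y))
  edgeBetweenBranches {x} {y} x<y seg@(x≢y , _ , _ , _ , _ , _ , _ , (p , _))
    with step (path-sym p) (x≢y ∘ ≡.sym ∘ κ-injective)
  ... | z , e , b = z , segment-inBranch x<y seg (between-sym b) (Adj⇒≢ e) , Adj-sym (graph G) e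

  -- Comparing distances in the minor with distances in the graph.

  expand : ∀ {x y} (p : Path minor x y) → Σ[ q ∈ Path G (κ x) (κ y) ] walkLength G q ≡ walkLength minor p
  expand [] = [] , refl
  expand (e ∷ p) with segment e | expand p
  ... | _ , _ , _ , _ , _ , _ , _ , (p₀ , _) | q , eq with ℓ-walk p₀
  ...   | q₀ , eq₀ = q₀ ◅◅ q , trans (walkLength-◅◅ G q₀ q) (cong₂ ℚ._+_ eq₀ eq)

  Compressed : V′ → V′ → Set
  Compressed x y = Σ[ p ∈ Path minor x y ] walkLength minor p ℚ.≤ ℓ (κ x) (κ y)

  compressed-refl : ∀ {x} → Compressed x x
  compressed-refl {x} = [] , 0≤ℓ (κ x) (κ x)

  compressed-split : ∀ {x z y} → Between (κ x) (κ z) (κ y) → Compressed x z → Compressed z y → Compressed x y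
  compressed-split b (p , p≤) (q , q≤) = p ◅◅ q ,
    ℚ.≤-trans (ℚ.≤-reflexive (walkLength-◅◅ minor p q)) (ℚ.≤-trans (ℚ.+-mono-≤ p≤ q≤) (ℓ-split b))

  -- Splitting at kept vertices strictly in between shortens the distance; once there is none, the
  -- ends are consecutive and joined by an edge of the minor.
  compress-good : ∀ {i u v x y} → Good i u v → On u v x y → Compressed x y
  compress-good {i} {u} {v} g = go (<-wellFounded _)
    where
    go : ∀ {x y} → Acc _<_ (d (κ x) (κ y)) → On u v x y → Compressed x y
    go {x} {y} (acc rec) on@(u-x-v , x-y-v) with x Fin.≟ y
    ... | yes refl = compressed-refl
    ... | no x≢y with Fin.any? (λ z → between? (κ x) (κ z) (κ y) ×-dec ¬? (z Fin.≟ x) ×-dec ¬? (z Fin.≟ y))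
    ...   | yes (z , b , z≢x , z≢y) = compressed-split b
              (go (rec (between-< b (z≢y ∘ κ-injective))) (u-x-v , proj₁ (nested-left x-y-v b)))
              (go (rec (between-<′ b (z≢x ∘ κ-injective))) (nested-mid u-x-v x-y-v b , proj₂ (nested-left x-y-v b)))
    ...   | no none = edge (x≢y , cons , i , u , v , g , on) ∷ [] , ℚ.≤-reflexive (ℚ.+-identityʳ _)
      where
      cons : Consecutive x y
      cons z b with z Fin.≟ x | z Fin.≟ y
      ... | yes z≡x | _ = inj₁ z≡x
      ... | _ | yes z≡y = inj₂ z≡y
      ... | no z≢x | no z≢y = contradiction (z , b , z≢x , z≢y) none

  -- Along the geodesic each vertex before `x` is not a portal, so the region covering the next edge
  -- must be the current one.
  spread : ∀ {i w x} → w ∈ region i → Path G w x → (∀ z → Between w z x → z ≢ x → z ∉ portals) → x ∈ region i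
  spread {i} {w} {x} = go (<-wellFounded (d w x))
    where
    go : ∀ {w} → Acc _<_ (d w x) → w ∈ region i → Path G w x → (∀ z → Between w z x → z ≢ x → z ∉ portals) → x ∈ region i
    go {w} (acc rec) w∈i p free with w Fin.≟ x
    ... | yes refl = w∈i
    ... | no w≢x with step p w≢x
    ...   | z , e , b with coverEdge e
    ...     | j , w∈j , z∈j with unique (free w (between-left p) w≢x) w∈i w∈j
    ...       | refl = go (rec (between-<′ b (Adj⇒≢ e))) z∈j (proj₁ (proj₂ b)) λ z′ b′ → free z′ (proj₁ (nested-right b b′))

  PortalFree : V → V → Set
  PortalFree s t = ∀ z → Between s z t → z ≢ s → z ≢ t → z ∉ portals

  spreadBack : ∀ {i s t w x} → PortalFree s t → Between s w t → w ≢ t → w ∈ region i → Between s x w → x ∈ region i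
  spreadBack {s = s} {t} {w} {x} free s-w-t w≢t w∈i s-x-w = spread w∈i (path-sym (proj₁ (proj₂ s-x-w))) λ z w-z-x z≢x →
    let s-z-w = proj₁ (nested-right s-x-w (between-sym w-z-x)) in
    free z (proj₁ (nested-left s-w-t s-z-w))
      (λ { refl → z≢x (between-antisym w-z-x (between-sym s-x-w)) })
      (λ { refl → w≢t (between-antisym s-w-t s-z-w) })

  -- Any inner vertex fixes the region, which then spreads from it in both directions up to the two
  -- end portals.
  portalFree-good : ∀ {s t} → s ∈ portals → t ∈ portals → Path G s t → s ≢ t → PortalFree s t → ∃[ i ] Good i s t
  portalFree-good {s} {t} s∈ t∈ p s≢t free
    with Fin.any? (λ w → between? s w t ×-dec ¬? (w Fin.≟ s) ×-dec ¬? (w Fin.≟ t))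
  ... | yes (w , b , w≢s , w≢t) =
    let i , w∈i = coverVertex w
        before-w : ∀ {x} → Between s x w → x ∈ region i
        before-w = spreadBack free b w≢t w∈i
        after-w : ∀ {x} → Between t x w → x ∈ region i
        after-w = spreadBack (λ z b′ z≢t z≢s → free z (between-sym b′) z≢s z≢t) (between-sym b) w≢s w∈i
    in i , good (portal∈boundary s∈ (before-w (between-left (proj₁ b))))
                (portal∈boundary t∈ (after-w (between-left (path-sym (proj₁ (proj₂ b))))))
                λ x b′ x≢s x≢t → (case linear b b′ of λ where
                    (inj₁ s-x-w) → before-w s-x-w
                    (inj₂ s-w-x) → after-w (between-sym (proj₂ (nested-left b′ s-w-x)))) ,
                  free x b′ x≢s x≢t
  -- Without inner vertices the geodesic is a single edge, and the region covering that edge is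
  -- taken.
  ... | no none with step p s≢t
  ...   | z , e , b with z Fin.≟ t
  ...     | no z≢t = contradiction (z , b , Adj⇒≢ e , z≢t) none
  ...     | yes refl = let i , s∈i , t∈i = coverEdge e in
            i , good (portal∈boundary s∈ s∈i) (portal∈boundary t∈ t∈i) λ w b′ w≢s w≢t → contradiction (w , b′ , w≢s , w≢t) none

  -- Split at portals as long as one lies strictly in between. All portals are kept, so the pieces
  -- that remain are good geodesics.
  compress : ∀ {x y} → κ x ∈ portals → κ y ∈ portals → Path G (κ x) (κ y) → Compressed x y
  compress = go (<-wellFounded _)
    where
    go : ∀ {x y} → Acc _<_ (d (κ x) (κ y)) → κ x ∈ portals → κ y ∈ portals → Path G (κ x) (κ y) → Compressed x y
    go {x} {y} (acc rec) x∈ y∈ p with x Fin.≟ y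
    ... | yes refl = compressed-refl
    ... | no x≢y with Fin.any? (λ z → between? (κ x) (κ z) (κ y) ×-dec ¬? (z Fin.≟ x) ×-dec ¬? (z Fin.≟ y) ×-dec κ z ∈? portals)
    ...   | yes (z , b , z≢x , z≢y , z∈) = compressed-split b
              (go (rec (between-< b (z≢y ∘ κ-injective))) x∈ z∈ (proj₁ b))
              (go (rec (between-<′ b (z≢x ∘ κ-injective))) z∈ y∈ (proj₁ (proj₂ b)))
    ...   | no none = compress-good (proj₂ (portalFree-good x∈ y∈ p (x≢y ∘ κ-injective) free)) (between-left p , between-right p)
      where
      free : PortalFree (κ x) (κ y)
      free z b z≢x z≢y z∈ with portal-Kept z∈
      ... | a , refl = none (a , b , z≢x ∘ cong κ , z≢y ∘ cong κ , z∈)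

  module _ {k : ℕ} (term : Fin k → V) (term-injective : Injective _≡_ _≡_ term) (term∈portals : ∀ i → term i ∈ portals) where

    τ : Fin k → V′
    τ i = proj₁ (portal-Kept (term∈portals i))

    κτ : ∀ i → term i ≡ κ (τ i)
    κτ i = proj₂ (portal-Kept (term∈portals i))

    dpMinor : DPMinor G k term minor
    dpMinor = record
      { φ = φ
      ; branchNonempty = λ x → κ x , φ-complete (inj₁ refl)
      ; branchConnected = λ x u v u∈ v∈ →
          let p , on-p = pathToCentre (φ-sound u∈)
              q , on-q = pathToCentre (φ-sound v∈)
          in p ◅◅ path-sym q , AllOn-◅◅ p (path-sym q) on-p (AllOn-reverse (Adj-sym (graph G)) q on-q)
      ; edgesRealised = λ x y e → realised x y (segment e)
      ; τ = τ
      ; τInj = λ {i} {j} eq → term-injective (trans (κτ i) (trans (cong κ eq) (≡.sym (κτ j))))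
      ; τBranch = λ i → φ-complete (inj₁ (κτ i))
      ; preserves = λ i j q → mk⇔ (forward i j) (backward i j)
      }
      where
      realised : ∀ x y → Segment x y → ∃[ u ] ∃[ v ] (φ u ≡ just x × φ v ≡ just y × Adj (graph G) u v)
      realised x y seg@(x≢y , _) with Fin.<-cmp x y
      ... | tri< x<y _ _ = let u , br , e = edgeBetweenBranches x<y seg
                           in u , κ y , φ-complete br , φ-complete (inj₁ refl) , e
      ... | tri≈ _ x≡y _ = contradiction x≡y x≢y
      ... | tri> _ _ y<x = let u , br , e = edgeBetweenBranches y<x (segment-sym seg)
                           in κ x , u , φ-complete (inj₁ refl) , φ-complete br , Adj-sym (graph G) e

      forward : ∀ i j {q} → DistAtMost G (term i) (term j) q → DistAtMost minor (τ i) (τ j) q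
      forward i j (p , p≤q) with compress (subst (_∈ portals) (κτ i) (term∈portals i)) (subst (_∈ portals) (κτ j) (term∈portals j))
                                          (≡.subst₂ (Path G) (κτ i) (κτ j) p)
      ... | p′ , p′≤ = p′ , ℚ.≤-trans p′≤
        (ℚ.≤-trans (ℚ.≤-reflexive (cong₂ ℓ (≡.sym (κτ i)) (≡.sym (κτ j)))) (ℚ.≤-trans (ℓ-min p) p≤q))

      backward : ∀ i j {q} → DistAtMost minor (τ i) (τ j) q → DistAtMost G (term i) (term j) q
      backward i j {q} (p , p≤q) with expand p
      ... | p′ , eq = ≡.subst₂ (λ u v → DistAtMost G u v q) (≡.sym (κτ i)) (≡.sym (κτ j)) (p′ , ℚ.≤-trans (ℚ.≤-reflexive eq) p≤q)

-- Cutting along bags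

module _ {G : Graph} {p : ℕ} (td : TreeDecomposition G p) where

  open TreeDecomposition td

  data Descendant (i : Fin m) : Fin (suc m) → Set where
    self : Descendant i (Fin.suc i)
    child : ∀ {j} → Descendant i (parent j) → Descendant i (Fin.suc j)

  descendant> : ∀ {i x} → Descendant i x → toℕ i < toℕ x
  descendant> self = ℕ.≤-refl
  descendant> (child {j} desc) = s≤s (ℕ.<⇒≤ (ℕ.<-≤-trans (descendant> desc) (parent< j)))

  -- Descendants of `Fin.suc i` have indices above `i`, so `x` is outside that subtree. The walk
  -- through bags containing `v` must leave the subtree, and the only way out is the edge to
  -- `parent i`.
  ∈parent : ∀ {i x v} → toℕ x ≤ toℕ i → v ∈ bag (Fin.suc i) → v ∈ bag x → v ∈ bag (parent i)
  ∈parent {i} {x} {v} x≤i v∈i v∈x with subtree v (Fin.suc i) x v∈i v∈x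
  ... | walk , on = leave self walk on
    where
    leave : ∀ {s} → Descendant i s → (walk : Walk TreeAdj s x) → AllOn (λ t → v ∈ bag t) walk → v ∈ bag (parent i)
    leave desc [] _ = contradiction (ℕ.<-≤-trans (descendant> desc) x≤i) (ℕ.<-irrefl refl)
    leave self (inj₁ (_ , refl , refl) ∷ walk) (_ , on) = AllOn-start walk on
    leave (child desc) (inj₁ (_ , refl , refl) ∷ walk) (_ , on) = leave desc walk on
    leave desc (inj₂ (_ , refl , eq) ∷ walk) (_ , on) = leave (child (subst (Descendant i) eq desc)) walk on

module _ {A : Set} (f : ℕ → A) (q : ℕ) (y : A) where

  opaque
    update : ℕ → A
    update t with t ℕ.≟ q
    ... | yes _ = y
    ... | no _ = f t

    -- Invariants of an updated state split into the new part at `q` and the old parts elsewhere;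
    -- `P` takes the index along with the value so that it can mention the bag of that node.
    update-elim : (P : ℕ → A → Set) → P q y → (∀ t → t ≢ q → P t (f t)) → ∀ t → P t (update t)
    update-elim P at-q off-q t with t ℕ.≟ q
    ... | yes refl = at-q
    ... | no t≢q = off-q t t≢q

  update-same : update q ≡ y
  update-same = update-elim (λ t a → t ≡ q → a ≡ y) (λ _ → refl) (λ t t≢q t≡q → contradiction t≡q t≢q) q refl

  update-other : ∀ {t} → t ≢ q → update t ≡ f t
  update-other {t} = update-elim (λ t a → t ≢ q → a ≡ f t) (λ q≢q → contradiction refl q≢q) (λ _ _ _ → refl) t

sumTo : (ℕ → ℕ) → ℕ → ℕ
sumTo f zero = f 0
sumTo f (suc j) = sumTo f j + f (suc j)

sumTo-cong : ∀ {f g} j → (∀ t → t ≤ j → g t ≡ f t) → sumTo g j ≡ sumTo f j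
sumTo-cong zero eq = eq 0 z≤n
sumTo-cong (suc j) eq = cong₂ _+_ (sumTo-cong j λ t t≤j → eq t (ℕ.m≤n⇒m≤1+n t≤j)) (eq (suc j) ℕ.≤-refl)

-- Stated with both values added across, which avoids truncated subtraction.
sumTo-exchange : ∀ {f g q} j → q ≤ j → (∀ t → t ≢ q → g t ≡ f t) → sumTo g j + f q ≡ sumTo f j + g q
sumTo-exchange {f} {g} zero z≤n eq = ℕ.+-comm (g 0) (f 0)
sumTo-exchange {f} {g} {q} (suc j) q≤ eq with q ℕ.≟ suc j
... | yes refl = trans (cong (λ s → s + g q + f q) (sumTo-cong j λ t t≤j → eq t (ℕ.<⇒≢ (s≤s t≤j)))) (swap (sumTo f j) (g q) (f q))
  where
  swap : ∀ a b c → a + b + c ≡ a + c + b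
  swap = solve-∀
... | no q≢ = begin
  sumTo g j + g (suc j) + f q ≡⟨ cong (λ s → sumTo g j + s + f q) (eq (suc j) (q≢ ∘ ≡.sym)) ⟩
  sumTo g j + f (suc j) + f q ≡⟨ swap (sumTo g j) (f (suc j)) (f q) ⟩
  sumTo g j + f q + f (suc j) ≡⟨ cong (_+ f (suc j)) (sumTo-exchange j (s≤s⁻¹ (ℕ.≤∧≢⇒< q≤ q≢)) eq) ⟩
  sumTo f j + g q + f (suc j) ≡⟨ swap (sumTo f j) (g q) (f (suc j)) ⟩
  sumTo f j + f (suc j) + g q ∎
  where
  open ≡.≡-Reasoning
  swap : ∀ a b c → a + b + c ≡ a + c + b
  swap = solve-∀

length-filter-split : ∀ {A : Set} {P : A → Set} (P? : Decidable P) (xs : List A) →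
                      length (filter P? xs) + length (filter (¬? ∘ P?) xs) ≡ length xs
length-filter-split P? [] = refl
length-filter-split P? (x ∷ xs) with P? x
... | yes _ = cong suc (length-filter-split P? xs)
... | no _ = trans (ℕ.+-suc _ _) (cong suc (length-filter-split P? xs))

-- The last node is repeatedly merged into its parent. When the parent has collected a charge of at
-- least 2p, everything merged into it is closed off as a region; only its bag, now on the boundary,
-- remains and is charged p. Every closed region thus lowers the total charge by at least p.
module Cutting {N : ℕ} {p : ℕ} (1≤p : 1 ≤ p) (m : ℕ) (bag : ℕ → List (Fin N)) (bagSize : ∀ t → length (bag t) ≤ suc p)
  (parent : ℕ → ℕ) (parent≤ : ∀ i → parent i ≤ i)
  (∈bag-parent : ∀ {i x v} → i < m → x ≤ i → v ∈ bag (suc i) → v ∈ bag x → v ∈ bag (parent i)) where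

  private V = Fin N

  open DecMembership (Fin._≟_ {N}) using (_∈?_)

  -- A closed region has at most `14 * p` boundary vertices. Two merged charges below `2 * p` and at
  -- most `2 * p` new ones from a bag make `6 * p`; boundary lists are at most twice as long as
  -- their charge, and the bag of the parent adds another `2 * p`.
  constant : ℕ
  constant = 14 ^ 4

  bag≤ : ∀ t → length (bag t) ≤ 2 * p
  bag≤ t = ℕ.≤-trans (bagSize t) (ℕ.≤-trans (ℕ.+-monoˡ-≤ p 1≤p) (ℕ.≤-reflexive (cong (p +_) (≡.sym (ℕ.+-identityʳ p)))))

  p<2p : p < 2 * p
  p<2p = ℕ.m<m+n p (ℕ.≤-trans 1≤p (ℕ.m≤m+n p 0))

  opaque
    -- Both bounds matter: `length U` lets the result be paid for by uncharged terminals, `length a`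
    -- keeps it within the size of a bag. Entries of `U` may repeat, so when filtering is too long
    -- the whole of `a` serves instead.
    capped : (U a : List V) → ∃[ c ] ((∀ {v} → v ∈ U → v ∈ a → v ∈ c) × (∀ {v} → v ∈ c → v ∈ a) × length c ≤ length U × length c ≤ length a)
    capped U a with length (filter (_∈? a) U) ℕ.≤? length a
    ... | yes short = filter (_∈? a) U , ∈-filter⁺ (_∈? a) , proj₂ ∘ ∈-filter⁻ (_∈? a) {xs = U} , length-filter (_∈? a) U , short
    ... | no long = a , (λ _ → id) , id , ℕ.≤-trans (ℕ.≰⇒≥ long) (length-filter (_∈? a) U) , ℕ.≤-refl

  -- Every required vertex of a part lies in its current bag or in bdry, whose vertices are paid for
  -- by charge; a terminal is paid for when it is in the bag of the merged node but not in its parent's.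
  record Part : Set where
    constructor part
    field
      verts : List V
      bdry : List V
      charge : ℕ

  open Part

  -- Nodes above `j` have been merged away. `required` holds the terminals and the bags cut along so
  -- far. `accounted` looks across parts: a vertex may be paid for in another part, and `separated`
  -- then still places it in the bags.
  record State (j : ℕ) : Set where
    field
      parts : ℕ → Part
      required uncharged : List V
      bag⊆verts : ∀ {t v} → t ≤ j → v ∈ bag t → v ∈ verts (parts t)
      separated : ∀ {t x v} → t ≤ j → x ≤ j → t ≢ x → v ∈ verts (parts t) → v ∈ verts (parts x) → v ∈ bag t
      bdry⊆verts : ∀ {t v} → t ≤ j → v ∈ bdry (parts t) → v ∈ verts (parts t)
      bdry≤ : ∀ {t} → t ≤ j → length (bdry (parts t)) ≤ 2 * charge (parts t)
      charge< : ∀ {t} → t ≤ j → charge (parts t) < 2 * p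
      located : ∀ {t v} → t ≤ j → v ∈ required → v ∈ verts (parts t) → v ∈ bag t ⊎ v ∈ bdry (parts t)
      accounted : ∀ {t v} → t ≤ j → v ∈ required → v ∈ verts (parts t) →
                  v ∈ uncharged ⊎ ∃[ x ] (x ≤ j × v ∈ bdry (parts x))

    potential : ℕ
    potential = sumTo (charge ∘ parts) j + length uncharged

  -- `portals⊆` and `region⊆` serve the induction: they confine the cut of the remainder to the
  -- remaining parts, so that a closed region meets it only in the bag of the node where it was
  -- detached.
  record Cut {j : ℕ} (s : State j) : Set where
    open State s
    field
      r : ℕ
      region boundary : Fin r → List V
      portals : List V
      covers : ∀ {t} → t ≤ j → ∃[ i ] (∀ {v} → v ∈ verts (parts t) → v ∈ region i)
      required⊆portals : ∀ {v} → v ∈ required → v ∈ portals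
      portals⊆ : ∀ {v} → v ∈ portals → v ∈ required ⊎ ∃[ t ] (t ≤ j × v ∈ verts (parts t))
      region⊆ : ∀ {v i} → v ∈ region i → ∃[ t ] (t ≤ j × v ∈ verts (parts t))
      unique : ∀ {v i i′} → v ∉ portals → v ∈ region i → v ∈ region i′ → i ≡ i′
      portal∈boundary : ∀ {v i} → v ∈ portals → v ∈ region i → v ∈ boundary i
      cost≤ : ∑ (λ i → length (boundary i) ^ 4) ≤ constant * p ^ 3 * potential

  -- Only three of the four factors are bounded by `6 * p`; the fourth is bounded through the
  -- potential, so the estimate survives when there are fewer than `p` terminals.
  wholeCost : ∀ {c w u} → c ≤ 2 * p → w < 2 * p → c ≤ u → (c + 2 * w) ^ 4 ≤ constant * p ^ 3 * (w + u)
  wholeCost {c} {w} {u} c≤2p w<2p c≤u = begin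
    (c + 2 * w) * (c + 2 * w) ^ 3
      ≤⟨ ℕ.*-mono-≤ (ℕ.+-monoˡ-≤ (2 * w) c≤u) (ℕ.^-monoˡ-≤ 3 (ℕ.+-mono-≤ c≤2p (ℕ.*-monoʳ-≤ 2 (ℕ.<⇒≤ w<2p)))) ⟩
    (u + 2 * w) * (2 * p + 2 * (2 * p)) ^ 3
      ≤⟨ ℕ.*-monoˡ-≤ _ (ℕ.+-monoˡ-≤ (2 * w) (ℕ.m≤m+n u (u + 0))) ⟩
    (2 * u + 2 * w) * (2 * p + 2 * (2 * p)) ^ 3
      ≡⟨ lemma u w p ⟩
    432 * (p ^ 3 * (w + u))
      -- Here 432 = 2 * 6^3, and 432 + 37984 = 14^4.
      ≤⟨ ℕ.*-monoˡ-≤ (p ^ 3 * (w + u)) (ℕ.m≤m+n 432 37984) ⟩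
    constant * (p ^ 3 * (w + u))
      ≡⟨ ℕ.*-assoc constant (p ^ 3) (w + u) ⟨
    constant * p ^ 3 * (w + u) ∎
    where
    open ℕ.≤-Reasoning
    lemma : ∀ u w p → let a = 2 * p + 2 * (2 * p) in
            (2 * u + 2 * w) * (a * (a * (a * 1))) ≡ 432 * (p * (p * (p * 1)) * (w + u))
    lemma = solve-∀

  closedCost : ∀ {b} → b ≤ 14 * p → b ^ 4 ≤ constant * p ^ 3 * p
  closedCost {b} b≤ = begin
    b ^ 4 ≤⟨ ℕ.^-monoˡ-≤ 4 b≤ ⟩
    (14 * p) ^ 4 ≡⟨ lemma p ⟩
    constant * p ^ 3 * p ∎
    where
    open ℕ.≤-Reasoning
    lemma : ∀ p → (14 * p) * ((14 * p) * ((14 * p) * ((14 * p) * 1))) ≡ 38416 * (p * (p * (p * 1))) * p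
    lemma = solve-∀

  -- Merging the last node `l` into its parent `q`.

  module Merge {j : ℕ} (j<m : j < m) (s : State (suc j)) where

    open State s

    l = suc j
    q = parent j

    S : ℕ → List V
    S t = verts (parts t)

    q≤j : q ≤ j
    q≤j = parent≤ j

    q≤l : q ≤ l
    q≤l = ℕ.m≤n⇒m≤1+n q≤j

    ≤j⇒≢l : ∀ {t} → t ≤ j → t ≢ l
    ≤j⇒≢l t≤j = ℕ.<⇒≢ (s≤s t≤j)

    ≤j⇒≤l : ∀ {t} → t ≤ j → t ≤ l
    ≤j⇒≤l = ℕ.m≤n⇒m≤1+n

    Departing : V → Set
    Departing v = v ∈ bag l × v ∉ bag q

    departing? : Decidable Departing
    departing? v = v ∈? bag l ×-dec ¬? (v ∈? bag q)

    newCharges = capped (filter departing? uncharged) (bag l)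
    pending = proj₁ newCharges
    uncharged′ = filter (¬? ∘ departing?) uncharged

    pending⊆bag : ∀ {v} → v ∈ pending → v ∈ bag l
    pending⊆bag = proj₁ (proj₂ (proj₂ newCharges))

    pending≤uncharged : length pending ≤ length (filter departing? uncharged)
    pending≤uncharged = proj₁ (proj₂ (proj₂ (proj₂ newCharges)))

    pending≤bag : length pending ≤ length (bag l)
    pending≤bag = proj₂ (proj₂ (proj₂ (proj₂ newCharges)))

    vertsM bdryM : List V
    vertsM = S q ++ S l
    bdryM = bdry (parts q) ++ bdry (parts l) ++ pending

    chargeM : ℕ
    chargeM = charge (parts q) + (charge (parts l) + length pending)

    lift-q : ∀ {v} → v ∈ bdry (parts q) → v ∈ bdryM
    lift-q = ∈-++⁺ˡ

    lift-l : ∀ {v} → v ∈ bdry (parts l) → v ∈ bdryM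
    lift-l = ∈-++⁺ʳ (bdry (parts q)) ∘ ∈-++⁺ˡ

    lift-pending : ∀ {v} → v ∈ pending → v ∈ bdryM
    lift-pending = ∈-++⁺ʳ (bdry (parts q)) ∘ ∈-++⁺ʳ (bdry (parts l))

    bdryM⊆vertsM : ∀ {v} → v ∈ bdryM → v ∈ vertsM
    bdryM⊆vertsM v∈ with ∈-++⁻ (bdry (parts q)) v∈
    ... | inj₁ v∈q = ∈-++⁺ˡ (bdry⊆verts q≤l v∈q)
    ... | inj₂ v∈l+ with ∈-++⁻ (bdry (parts l)) v∈l+
    ...   | inj₁ v∈l = ∈-++⁺ʳ (S q) (bdry⊆verts ℕ.≤-refl v∈l)
    ...   | inj₂ v∈pending = ∈-++⁺ʳ (S q) (bag⊆verts ℕ.≤-refl (pending⊆bag v∈pending))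

    length-bdryM : length bdryM ≤ 2 * chargeM
    length-bdryM = begin
      length bdryM ≡⟨ trans (length-++ (bdry (parts q))) (cong (length (bdry (parts q)) +_) (length-++ (bdry (parts l)))) ⟩
      length (bdry (parts q)) + (length (bdry (parts l)) + length pending)
        ≤⟨ ℕ.+-mono-≤ (bdry≤ q≤l) (ℕ.+-mono-≤ (bdry≤ ℕ.≤-refl) (ℕ.m≤m+n (length pending) (length pending + 0))) ⟩
      2 * charge (parts q) + (2 * charge (parts l) + 2 * length pending)
        ≡⟨ lemma (charge (parts q)) (charge (parts l)) (length pending) ⟩
      2 * chargeM ∎
      where
      open ℕ.≤-Reasoning
      lemma : ∀ a b c → 2 * a + (2 * b + 2 * c) ≡ 2 * (a + (b + c))
      lemma = solve-∀

    chargeM≤ : chargeM ≤ 6 * p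
    chargeM≤ = ℕ.≤-trans (ℕ.+-mono-≤ (ℕ.<⇒≤ (charge< q≤l)) (ℕ.+-mono-≤ (ℕ.<⇒≤ (charge< ℕ.≤-refl)) (ℕ.≤-trans pending≤bag (bag≤ l))))
      (ℕ.≤-reflexive (lemma p))
      where
      lemma : ∀ p → 2 * p + (2 * p + 2 * p) ≡ 6 * p
      lemma = solve-∀

    -- A vertex that comes from `l` lies in `bag l` and in `bag t`, so the connectedness of its bags
    -- puts it into `bag q` as well.
    separatedM : ∀ {t v} → t ≤ j → t ≢ q → v ∈ S t → v ∈ vertsM → v ∈ bag q × v ∈ bag t
    separatedM {t} t≤j t≢q v∈t v∈M with ∈-++⁻ (S q) v∈M
    ... | inj₁ v∈q = separated q≤l (≤j⇒≤l t≤j) (t≢q ∘ ≡.sym) v∈q v∈t , separated (≤j⇒≤l t≤j) q≤l t≢q v∈t v∈q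
    ... | inj₂ v∈l = ∈bag-parent j<m t≤j (separated ℕ.≤-refl (≤j⇒≤l t≤j) (≤j⇒≢l t≤j ∘ ≡.sym) v∈l v∈t) v∈bag , v∈bag
      where v∈bag = separated (≤j⇒≤l t≤j) ℕ.≤-refl (≤j⇒≢l t≤j) v∈t v∈l

    Accounted′ : V → Set
    Accounted′ v = v ∈ uncharged′ ⊎ v ∈ bdryM ⊎ ∃[ x ] (x ≤ j × x ≢ q × v ∈ bdry (parts x))

    account : ∀ {v} → v ∈ uncharged ⊎ ∃[ x ] (x ≤ l × v ∈ bdry (parts x)) → Accounted′ v
    account {v} (inj₁ v∈U) with departing? v
    ... | yes dep = inj₂ (inj₁ (lift-pending (proj₁ (proj₂ newCharges) (∈-filter⁺ departing? v∈U dep) (proj₁ dep))))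
    ... | no stays = inj₁ (∈-filter⁺ (¬? ∘ departing?) v∈U stays)
    account (inj₂ (x , x≤l , v∈x)) with x ℕ.≟ q | x ℕ.≟ l
    ... | yes refl | _ = inj₂ (inj₁ (lift-q v∈x))
    ... | no _ | yes refl = inj₂ (inj₁ (lift-l v∈x))
    ... | no x≢q | no x≢l = inj₂ (inj₂ (x , s≤s⁻¹ (ℕ.≤∧≢⇒< x≤l x≢l) , x≢q , v∈x))

    -- The critical case is a vertex of `bag l` that is missing from `bag q`. If uncharged, it is
    -- departing and is put on the boundary now; if another part has paid for it, that part shares
    -- it with the merged one, which forces it into `bag q`.
    locatedM : ∀ {v} → v ∈ required → v ∈ vertsM → v ∈ bag q ⊎ v ∈ bdryM
    locatedM {v} v∈R v∈M with ∈-++⁻ (S q) v∈M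
    ... | inj₁ v∈q = [ inj₁ , inj₂ ∘ lift-q ]′ (located q≤l v∈R v∈q)
    ... | inj₂ v∈l with located ℕ.≤-refl v∈R v∈l
    ...   | inj₂ v∈b = inj₂ (lift-l v∈b)
    ...   | inj₁ v∈bag-l with v ∈? bag q
    ...     | yes v∈bag-q = inj₁ v∈bag-q
    ...     | no v∉bag-q with account (accounted ℕ.≤-refl v∈R v∈l)
    ...       | inj₁ v∈U′ = contradiction (v∈bag-l , v∉bag-q) (proj₂ (∈-filter⁻ (¬? ∘ departing?) {xs = uncharged} v∈U′))
    ...       | inj₂ (inj₁ v∈b) = inj₂ v∈b
    ...       | inj₂ (inj₂ (x , x≤j , x≢q , v∈x)) = inj₁ (proj₁ (separatedM x≤j x≢q (bdry⊆verts (≤j⇒≤l x≤j) v∈x) v∈M))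

    accountedM : ∀ {v} → v ∈ required → v ∈ vertsM → Accounted′ v
    accountedM v∈R v∈M with ∈-++⁻ (S q) v∈M
    ... | inj₁ v∈q = account (accounted q≤l v∈R v∈q)
    ... | inj₂ v∈l = account (accounted ℕ.≤-refl v∈R v∈l)

    -- Bookkeeping shared by both outcomes: `c` is the new charge at `q`, namely `chargeM` after
    -- absorbing and `p` after detaching.
    potential-split : ∀ c → (parts′ : ℕ → Part) → (∀ t → t ≢ q → parts′ t ≡ parts t) → charge (parts′ q) ≡ c →
                      sumTo (charge ∘ parts′) j + length uncharged′ + chargeM ≤ potential + c
    potential-split c parts′ same refl = begin
      sumTo (charge ∘ parts′) j + u′ + (charge (parts q) + (charge (parts l) + length pending))
        ≤⟨ ℕ.+-monoʳ-≤ (sumTo (charge ∘ parts′) j + u′) (ℕ.+-monoʳ-≤ (charge (parts q)) (ℕ.+-monoʳ-≤ (charge (parts l)) pending≤uncharged)) ⟩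
      sumTo (charge ∘ parts′) j + u′ + (charge (parts q) + (charge (parts l) + u″))
        ≡⟨ lemma₁ (sumTo (charge ∘ parts′) j) u′ (charge (parts q)) (charge (parts l)) u″ ⟩
      sumTo (charge ∘ parts′) j + charge (parts q) + (charge (parts l) + (u″ + u′))
        ≡⟨ cong₂ (λ a b → a + (charge (parts l) + b)) (sumTo-exchange j q≤j (λ t t≢q → cong charge (same t t≢q))) (length-filter-split departing? uncharged) ⟩
      sumTo (charge ∘ parts) j + charge (parts′ q) + (charge (parts l) + length uncharged)
        ≡⟨ lemma₂ (sumTo (charge ∘ parts) j) (charge (parts′ q)) (charge (parts l)) (length uncharged) ⟩
      sumTo (charge ∘ parts) j + charge (parts l) + length uncharged + charge (parts′ q) ∎
      where
      open ℕ.≤-Reasoning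
      u′ = length uncharged′
      u″ = length (filter departing? uncharged)
      lemma₁ : ∀ a b c e f → a + b + (c + (e + f)) ≡ a + c + (e + (f + b))
      lemma₁ = solve-∀
      lemma₂ : ∀ a b c e → a + b + (c + e) ≡ a + c + e + b
      lemma₂ = solve-∀

    module _ (light : chargeM < 2 * p) where

      parts∪ : ℕ → Part
      parts∪ = update parts q (part vertsM bdryM chargeM)

      at-q : parts∪ q ≡ part vertsM bdryM chargeM
      at-q = update-same parts q _

      ∈bdry∪ : ∀ {v} → Accounted′ v → v ∈ uncharged′ ⊎ ∃[ x ] (x ≤ j × v ∈ bdry (parts∪ x))
      ∈bdry∪ (inj₁ v∈U′) = inj₁ v∈U′
      ∈bdry∪ (inj₂ (inj₁ v∈M)) = inj₂ (q , q≤j , subst (λ P → _ ∈ bdry P) (≡.sym at-q) v∈M)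
      ∈bdry∪ (inj₂ (inj₂ (x , x≤j , x≢q , v∈x))) =
        inj₂ (x , x≤j , subst (λ P → _ ∈ bdry P) (≡.sym (update-other parts q _ x≢q)) v∈x)

      absorb : State j
      absorb = record
        { parts = parts∪
        ; required = required
        ; uncharged = uncharged′
        ; bag⊆verts = λ {t} {v} → update-elim parts q _ (λ t P → t ≤ j → v ∈ bag t → v ∈ verts P)
            (λ _ → ∈-++⁺ˡ ∘ bag⊆verts q≤l) (λ t _ t≤j → bag⊆verts (≤j⇒≤l t≤j)) t
        ; separated = λ {t} {x} {v} → update-elim parts q _
            (λ t P → t ≤ j → x ≤ j → t ≢ x → v ∈ verts P → v ∈ verts (parts∪ x) → v ∈ bag t)
            (λ _ → update-elim parts q _ (λ x P → x ≤ j → q ≢ x → v ∈ vertsM → v ∈ verts P → v ∈ bag q)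
              (λ _ q≢q → contradiction refl q≢q)
              (λ x x≢q x≤j _ v∈M v∈x → proj₁ (separatedM x≤j x≢q v∈x v∈M)) x)
            (λ t t≢q t≤j → update-elim parts q _ (λ x P → x ≤ j → t ≢ x → v ∈ S t → v ∈ verts P → v ∈ bag t)
              (λ _ _ v∈t v∈M → proj₂ (separatedM t≤j t≢q v∈t v∈M))
              (λ x x≢q x≤j t≢x → separated (≤j⇒≤l t≤j) (≤j⇒≤l x≤j) t≢x) x)
            t
        ; bdry⊆verts = λ {t} {v} → update-elim parts q _ (λ t P → t ≤ j → v ∈ bdry P → v ∈ verts P)
            (λ _ → bdryM⊆vertsM) (λ t _ t≤j → bdry⊆verts (≤j⇒≤l t≤j)) t
        ; bdry≤ = λ {t} → update-elim parts q _ (λ t P → t ≤ j → length (bdry P) ≤ 2 * charge P)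
            (λ _ → length-bdryM) (λ t _ t≤j → bdry≤ (≤j⇒≤l t≤j)) t
        ; charge< = λ {t} → update-elim parts q _ (λ t P → t ≤ j → charge P < 2 * p)
            (λ _ → light) (λ t _ t≤j → charge< (≤j⇒≤l t≤j)) t
        ; located = λ {t} {v} → update-elim parts q _ (λ t P → t ≤ j → v ∈ required → v ∈ verts P → v ∈ bag t ⊎ v ∈ bdry P)
            (λ _ → locatedM) (λ t _ t≤j → located (≤j⇒≤l t≤j)) t
        ; accounted = λ {t} {v} t≤j v∈R v∈t → ∈bdry∪ (update-elim parts q _
            (λ t P → t ≤ j → v ∈ verts P → Accounted′ v)
            (λ _ → accountedM v∈R) (λ t _ t≤j v∈t → account (accounted (≤j⇒≤l t≤j) v∈R v∈t)) t t≤j v∈t)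
        }

      absorbed⊆ : ∀ {t v} → t ≤ j → v ∈ verts (parts∪ t) → ∃[ x ] (x ≤ l × v ∈ S x)
      absorbed⊆ {t} {v} = update-elim parts q _ (λ t P → t ≤ j → v ∈ verts P → ∃[ x ] (x ≤ l × v ∈ S x))
        (λ _ v∈M → [ (λ v∈q → q , q≤l , v∈q) , (λ v∈l → l , ℕ.≤-refl , v∈l) ]′ (∈-++⁻ (S q) v∈M))
        (λ t _ t≤j v∈t → t , ≤j⇒≤l t≤j , v∈t) t

      -- The same regions serve. The potential does not grow, because the pending vertices are no
      -- more numerous than the terminals that cease to be uncharged.
      cut-absorb : Cut absorb → Cut s
      cut-absorb c = record
        { r = K.r ; region = K.region ; boundary = K.boundary ; portals = K.portals
        ; covers = covers
        ; required⊆portals = K.required⊆portals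
        ; portals⊆ = λ v∈ → [ inj₁ , (λ (t , t≤j , v∈t) → inj₂ (absorbed⊆ t≤j v∈t)) ]′ (K.portals⊆ v∈)
        ; region⊆ = λ v∈ → let t , t≤j , v∈t = K.region⊆ v∈ in absorbed⊆ t≤j v∈t
        ; unique = K.unique
        ; portal∈boundary = K.portal∈boundary
        ; cost≤ = ℕ.≤-trans K.cost≤ (ℕ.*-monoʳ-≤ (constant * p ^ 3) (ℕ.+-cancelʳ-≤ chargeM _ _
            (potential-split chargeM parts∪ (λ _ → update-other parts q _) (cong charge at-q))))
        }
        where
        module K = Cut c
        covers : ∀ {t} → t ≤ l → ∃[ i ] (∀ {v} → v ∈ S t → v ∈ K.region i)
        covers {t} t≤l with t ℕ.≟ l | t ℕ.≟ q | K.covers q≤j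
        ... | yes refl | _ | i , in-i = i , λ v∈ → in-i (subst (λ P → _ ∈ verts P) (≡.sym at-q) (∈-++⁺ʳ (S q) v∈))
        ... | no _ | yes refl | i , in-i = i , λ v∈ → in-i (subst (λ P → _ ∈ verts P) (≡.sym at-q) (∈-++⁺ˡ v∈))
        ... | no t≢l | no t≢q | _ with K.covers (s≤s⁻¹ (ℕ.≤∧≢⇒< t≤l t≢l))
        ...   | i , in-i = i , λ v∈ → in-i (subst (λ P → _ ∈ verts P) (≡.sym (update-other parts q _ t≢q)) v∈)

    module _ (heavy : 2 * p ≤ chargeM) where

      parts∖ : ℕ → Part
      parts∖ = update parts q (part (bag q) (bag q) p)

      at-q∖ : parts∖ q ≡ part (bag q) (bag q) p
      at-q∖ = update-same parts q _

      ∈bdry∖ : ∀ {v} → v ∈ bag q → ∃[ x ] (x ≤ j × v ∈ bdry (parts∖ x))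
      ∈bdry∖ v∈ = q , q≤j , subst (λ P → _ ∈ bdry P) (≡.sym at-q∖) v∈

      -- The bag left at `q` can have `p + 1` vertices but is charged `p`; the factor 2 in `bdry≤`
      -- absorbs this. A charge of `p + 1` would guarantee a drop of only `p - 1`, which is nothing
      -- for `p = 1`. Making `bag q` required turns it into portals.
      detach : State j
      detach = record
        { parts = parts∖
        ; required = bag q ++ required
        ; uncharged = uncharged′
        ; bag⊆verts = λ {t} {v} → update-elim parts q _ (λ t P → t ≤ j → v ∈ bag t → v ∈ verts P)
            (λ _ → id) (λ t _ t≤j → bag⊆verts (≤j⇒≤l t≤j)) t
        ; separated = λ {t} {x} {v} → update-elim parts q _
            (λ t P → t ≤ j → x ≤ j → t ≢ x → v ∈ verts P → v ∈ verts (parts∖ x) → v ∈ bag t)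
            (λ _ _ _ v∈q _ → v∈q)
            (λ t t≢q t≤j → update-elim parts q _ (λ x P → x ≤ j → t ≢ x → v ∈ S t → v ∈ verts P → v ∈ bag t)
              (λ _ _ v∈t v∈q → separated (≤j⇒≤l t≤j) q≤l t≢q v∈t (bag⊆verts q≤l v∈q))
              (λ x x≢q x≤j t≢x → separated (≤j⇒≤l t≤j) (≤j⇒≤l x≤j) t≢x) x)
            t
        ; bdry⊆verts = λ {t} {v} → update-elim parts q _ (λ t P → t ≤ j → v ∈ bdry P → v ∈ verts P)
            (λ _ → id) (λ t _ t≤j → bdry⊆verts (≤j⇒≤l t≤j)) t
        ; bdry≤ = λ {t} → update-elim parts q _ (λ t P → t ≤ j → length (bdry P) ≤ 2 * charge P)
            (λ _ → bag≤ q) (λ t _ t≤j → bdry≤ (≤j⇒≤l t≤j)) t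
        ; charge< = λ {t} → update-elim parts q _ (λ t P → t ≤ j → charge P < 2 * p)
            (λ _ → p<2p) (λ t _ t≤j → charge< (≤j⇒≤l t≤j)) t
        ; located = λ {t} {v} t≤j v∈R → update-elim parts q _ (λ t P → t ≤ j → v ∈ verts P → v ∈ bag t ⊎ v ∈ bdry P)
            (λ _ → inj₁)
            (λ t t≢q t≤j v∈t → case ∈-++⁻ (bag q) v∈R of λ where
              (inj₁ v∈q) → inj₁ (separated (≤j⇒≤l t≤j) q≤l t≢q v∈t (bag⊆verts q≤l v∈q))
              (inj₂ v∈R) → located (≤j⇒≤l t≤j) v∈R v∈t) t t≤j
        ; accounted = λ {t} {v} t≤j v∈R → update-elim parts q _
            (λ t P → t ≤ j → v ∈ verts P → v ∈ uncharged′ ⊎ ∃[ x ] (x ≤ j × v ∈ bdry (parts∖ x)))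
            (λ _ v∈q → inj₂ (∈bdry∖ v∈q))
            (λ t t≢q t≤j v∈t → case ∈-++⁻ (bag q) v∈R of λ where
              (inj₁ v∈q) → inj₂ (∈bdry∖ v∈q)
              (inj₂ v∈R) → case account (accounted (≤j⇒≤l t≤j) v∈R v∈t) of λ where
                (inj₁ v∈U′) → inj₁ v∈U′
                (inj₂ (inj₁ v∈M)) → inj₂ (∈bdry∖ (proj₁ (separatedM t≤j t≢q v∈t (bdryM⊆vertsM v∈M))))
                (inj₂ (inj₂ (x , x≤j , x≢q , v∈x))) →
                  inj₂ (x , x≤j , subst (λ P → v ∈ bdry P) (≡.sym (update-other parts q _ x≢q)) v∈x)) t t≤j
        }

      detached⊆ : ∀ {t v} → t ≤ j → v ∈ verts (parts∖ t) → v ∈ bag q ⊎ (t ≢ q × v ∈ S t)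
      detached⊆ {t} {v} = update-elim parts q _ (λ t P → t ≤ j → v ∈ verts P → v ∈ bag q ⊎ (t ≢ q × v ∈ S t))
        (λ _ → inj₁) (λ t t≢q _ v∈t → inj₂ (t≢q , v∈t)) t

      bag-q⊆ : ∀ {v} → v ∈ bag q → ∃[ x ] (x ≤ l × v ∈ S x)
      bag-q⊆ v∈q = q , q≤l , bag⊆verts q≤l v∈q

      detached⊆S : ∀ {v} → ∃[ t ] (t ≤ j × v ∈ verts (parts∖ t)) → ∃[ x ] (x ≤ l × v ∈ S x)
      detached⊆S (t , t≤j , v∈t) = [ bag-q⊆ , (λ (_ , v∈t) → t , ≤j⇒≤l t≤j , v∈t) ]′ (detached⊆ t≤j v∈t)

      detached∩M : ∀ {v} → ∃[ t ] (t ≤ j × v ∈ verts (parts∖ t)) → v ∈ vertsM → v ∈ bag q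
      detached∩M (t , t≤j , v∈t) v∈M = [ id , (λ (t≢q , v∈t) → proj₁ (separatedM t≤j t≢q v∈t v∈M)) ]′ (detached⊆ t≤j v∈t)

      boundaryM≤ : length (bdryM ++ bag q) ≤ 14 * p
      boundaryM≤ = begin
        length (bdryM ++ bag q) ≡⟨ length-++ bdryM ⟩
        length bdryM + length (bag q) ≤⟨ ℕ.+-mono-≤ (ℕ.≤-trans length-bdryM (ℕ.*-monoʳ-≤ 2 chargeM≤)) (bag≤ q) ⟩
        2 * (6 * p) + 2 * p ≡⟨ lemma p ⟩
        14 * p ∎
        where
        open ℕ.≤-Reasoning
        lemma : ∀ p → 2 * (6 * p) + 2 * p ≡ 14 * p
        lemma = solve-∀

      -- At least `2 * p` of charge leaves with the closed part and `p` returns with the bare bag;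
      -- the difference pays for `closedCost`.
      potential-drop : p + State.potential detach ≤ potential
      potential-drop = ℕ.+-cancelʳ-≤ p _ _ (begin
        p + State.potential detach + p ≡⟨ lemma p (State.potential detach) ⟩
        State.potential detach + 2 * p ≤⟨ ℕ.+-monoʳ-≤ (State.potential detach) heavy ⟩
        State.potential detach + chargeM ≤⟨ potential-split p parts∖ (λ _ → update-other parts q _) (cong charge at-q∖) ⟩
        potential + p ∎)
        where
        open ℕ.≤-Reasoning
        lemma : ∀ a b → a + b + a ≡ b + 2 * a
        lemma = solve-∀

      cut-detach : Cut detach → Cut s
      cut-detach c = record
        { r = suc K.r
        ; region = region
        ; boundary = boundary
        ; portals = K.portals
        ; covers = covers
        ; required⊆portals = K.required⊆portals ∘ ∈-++⁺ʳ (bag q)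
        ; portals⊆ = λ v∈ → [ (λ v∈R → [ inj₂ ∘ bag-q⊆ , inj₁ ]′ (∈-++⁻ (bag q) v∈R)) , inj₂ ∘ detached⊆S ]′ (K.portals⊆ v∈)
        ; region⊆ = λ { {i = Fin.zero} v∈M → [ (λ v∈q → q , q≤l , v∈q) , (λ v∈l → l , ℕ.≤-refl , v∈l) ]′ (∈-++⁻ (S q) v∈M)
                      ; {i = Fin.suc i} v∈ → detached⊆S (K.region⊆ v∈) }
        ; unique = unique
        ; portal∈boundary = λ { {i = Fin.zero} → portal∈M ; {i = Fin.suc i} → K.portal∈boundary }
        ; cost≤ = begin
            length (bdryM ++ bag q) ^ 4 + ∑ (λ i → length (K.boundary i) ^ 4)
              ≤⟨ ℕ.+-mono-≤ (closedCost boundaryM≤) K.cost≤ ⟩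
            constant * p ^ 3 * p + constant * p ^ 3 * State.potential detach
              ≡⟨ ℕ.*-distribˡ-+ (constant * p ^ 3) p (State.potential detach) ⟨
            constant * p ^ 3 * (p + State.potential detach)
              ≤⟨ ℕ.*-monoʳ-≤ (constant * p ^ 3) potential-drop ⟩
            constant * p ^ 3 * potential ∎
        }
        where
        open ℕ.≤-Reasoning
        module K = Cut c

        region boundary : Fin (suc K.r) → List V
        region Fin.zero = vertsM
        region (Fin.suc i) = K.region i
        boundary Fin.zero = bdryM ++ bag q
        boundary (Fin.suc i) = K.boundary i

        covers : ∀ {t} → t ≤ l → ∃[ i ] (∀ {v} → v ∈ S t → v ∈ region i)
        covers {t} t≤l with t ℕ.≟ l | t ℕ.≟ q
        ... | yes refl | _ = Fin.zero , ∈-++⁺ʳ (S q)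
        ... | no _ | yes refl = Fin.zero , ∈-++⁺ˡ
        ... | no t≢l | no t≢q with K.covers (s≤s⁻¹ (ℕ.≤∧≢⇒< t≤l t≢l))
        ...   | i , in-i = Fin.suc i , λ v∈ → in-i (subst (λ P → _ ∈ verts P) (≡.sym (update-other parts q _ t≢q)) v∈)

        -- The closed part and the remainder share only vertices of `bag q`, all of which are
        -- portals.
        disjoint : ∀ {v i} → v ∉ K.portals → v ∈ vertsM → v ∉ K.region i
        disjoint v∉ v∈M v∈i = v∉ (K.required⊆portals (∈-++⁺ˡ (detached∩M (K.region⊆ v∈i) v∈M)))

        unique : ∀ {v i i′} → v ∉ K.portals → v ∈ region i → v ∈ region i′ → i ≡ i′
        unique {i = Fin.zero} {Fin.zero} _ _ _ = refl
        unique {i = Fin.zero} {Fin.suc _} v∉ v∈M v∈i = contradiction v∈i (disjoint v∉ v∈M)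
        unique {i = Fin.suc _} {Fin.zero} v∉ v∈i v∈M = contradiction v∈i (disjoint v∉ v∈M)
        unique {i = Fin.suc _} {Fin.suc _} v∉ v∈i v∈i′ = cong Fin.suc (K.unique v∉ v∈i v∈i′)

        -- A portal contributed by the remainder can reach the closed part only through `bag q`; an
        -- older required vertex is handled by `locatedM`.
        portal∈M : ∀ {v} → v ∈ K.portals → v ∈ vertsM → v ∈ bdryM ++ bag q
        portal∈M v∈ v∈M with K.portals⊆ v∈
        ... | inj₂ at-t = ∈-++⁺ʳ bdryM (detached∩M at-t v∈M)
        ... | inj₁ v∈R+ with ∈-++⁻ (bag q) v∈R+
        ...   | inj₁ v∈q = ∈-++⁺ʳ bdryM v∈q
        ...   | inj₂ v∈R = [ ∈-++⁺ʳ bdryM , ∈-++⁺ˡ ]′ (locatedM v∈R v∈M)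

  -- The root has no parent to pass its bag on to, so the uncharged terminals of `bag 0` join the
  -- boundary directly, capped by the size of that bag.
  cut-whole : (s : State 0) → Cut s
  cut-whole s = record
    { r = 1
    ; region = λ _ → verts (parts 0)
    ; boundary = λ _ → proj₁ rest ++ bdry (parts 0)
    ; portals = required
    ; covers = λ { z≤n → Fin.zero , id }
    ; required⊆portals = id
    ; portals⊆ = inj₁
    ; region⊆ = λ v∈ → 0 , z≤n , v∈
    ; unique = λ { {i = Fin.zero} {Fin.zero} _ _ _ → refl }
    ; portal∈boundary = portal∈boundary
    ; cost≤ = begin
        length (proj₁ rest ++ bdry (parts 0)) ^ 4 + 0
          ≡⟨ ℕ.+-identityʳ _ ⟩
        length (proj₁ rest ++ bdry (parts 0)) ^ 4
          ≤⟨ ℕ.^-monoˡ-≤ 4 (ℕ.≤-trans (ℕ.≤-reflexive (length-++ (proj₁ rest))) (ℕ.+-monoʳ-≤ (length (proj₁ rest)) (bdry≤ z≤n))) ⟩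
        (length (proj₁ rest) + 2 * charge (parts 0)) ^ 4
          ≤⟨ wholeCost (ℕ.≤-trans (proj₂ (proj₂ (proj₂ (proj₂ rest)))) (bag≤ 0)) (charge< z≤n) (proj₁ (proj₂ (proj₂ (proj₂ rest)))) ⟩
        constant * p ^ 3 * potential ∎
    }
    where
    open State s
    open ℕ.≤-Reasoning
    rest = capped uncharged (bag 0)
    portal∈boundary : ∀ {v} → v ∈ required → v ∈ verts (parts 0) → v ∈ proj₁ rest ++ bdry (parts 0)
    portal∈boundary v∈R v∈S with located z≤n v∈R v∈S
    ... | inj₂ v∈b = ∈-++⁺ʳ (proj₁ rest) v∈b
    ... | inj₁ v∈bag with accounted z≤n v∈R v∈S
    ...   | inj₁ v∈U = ∈-++⁺ˡ (proj₁ (proj₂ rest) v∈U v∈bag)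
    ...   | inj₂ (_ , z≤n , v∈b) = ∈-++⁺ʳ (proj₁ rest) v∈b

  cut : ∀ j → j ≤ m → (s : State j) → Cut s
  cut zero _ s = cut-whole s
  cut (suc j) j<m s with Merge.chargeM j<m s ℕ.<? 2 * p
  ... | yes light = Merge.cut-absorb j<m s light (cut j (ℕ.<⇒≤ j<m) (Merge.absorb j<m s light))
  ... | no heavy = Merge.cut-detach j<m s (ℕ.≮⇒≥ heavy) (cut j (ℕ.<⇒≤ j<m) (Merge.detach j<m s (ℕ.≮⇒≥ heavy)))

  -- Nothing is charged yet, so the potential equals the number of terminals; this makes the final
  -- bound linear in it.
  initial : List V → State m
  initial terminals = record
    { parts = λ t → part (bag t) [] 0
    ; required = terminals
    ; uncharged = terminals
    ; bag⊆verts = λ _ → id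
    ; separated = λ _ _ _ v∈t _ → v∈t
    ; bdry⊆verts = λ _ ()
    ; bdry≤ = λ _ → z≤n
    ; charge< = λ _ → ℕ.≤-trans (s≤s z≤n) p<2p
    ; located = λ _ _ → inj₁
    ; accounted = λ _ v∈R _ → inj₁ v∈R
    }

-- Tree nodes numbered by naturals, and the resulting bound.

module _ {G : Graph} {p : ℕ} (td : TreeDecomposition G p) where

  open TreeDecomposition td

  -- Junk beyond m.
  node : ℕ → Fin (suc m)
  node t with t ℕ.<? suc m
  ... | yes t≤m = fromℕ< t≤m
  ... | no _ = Fin.zero

  node-toℕ : ∀ x → node (toℕ x) ≡ x
  node-toℕ x with toℕ x ℕ.<? suc m
  ... | yes x≤m = Fin.fromℕ<-toℕ x x≤m
  ... | no x≰m = contradiction (Fin.toℕ<n x) x≰m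

  toℕ-node : ∀ {t} → t ≤ m → toℕ (node t) ≡ t
  toℕ-node {t} t≤m with t ℕ.<? suc m
  ... | yes t≤m = Fin.toℕ-fromℕ< t≤m
  ... | no t≰m = contradiction (s≤s t≤m) t≰m

  parentℕ : ℕ → ℕ
  parentℕ i with i ℕ.<? m
  ... | yes i<m = toℕ (parent (fromℕ< i<m))
  ... | no _ = 0

  parentℕ≤ : ∀ i → parentℕ i ≤ i
  parentℕ≤ i with i ℕ.<? m
  ... | yes i<m = ℕ.≤-trans (parent< (fromℕ< i<m)) (ℕ.≤-reflexive (Fin.toℕ-fromℕ< i<m))
  ... | no _ = z≤n

  ∈parentℕ : ∀ {i x v} → i < m → x ≤ i → v ∈ bag (node (suc i)) → v ∈ bag (node x) → v ∈ bag (node (parentℕ i))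
  ∈parentℕ {i} {x} {v} i<m x≤i v∈i v∈x with i ℕ.<? m
  ... | no i≮m = contradiction i<m i≮m
  ... | yes i<m = subst (λ t → v ∈ bag t) (≡.sym (node-toℕ (parent i′)))
    (∈parent td (≡.subst₂ _≤_ (≡.sym (toℕ-node (ℕ.<⇒≤ (ℕ.≤-<-trans x≤i i<m)))) (≡.sym (Fin.toℕ-fromℕ< i<m)) x≤i)
      (subst (λ t → v ∈ bag t) (trans (cong (node ∘ suc) (≡.sym (Fin.toℕ-fromℕ< i<m))) (node-toℕ (Fin.suc i′))) v∈i) v∈x)
    where i′ = fromℕ< i<m

sumTo-zero : ∀ j → sumTo (λ _ → 0) j ≡ 0
sumTo-zero zero = refl
sumTo-zero (suc j) = cong (_+ 0) (sumTo-zero j)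

regions : ∀ {p} → 1 ≤ p → (G : WGraph) → TreewidthAtMost (graph G) p → (terminals : List (Vertex G)) →
          Σ[ R ∈ Regions G ] ((∀ {v} → v ∈ terminals → v ∈ Regions.portals R) ×
                              Regions.cost R ≤ 14 ^ 4 * p ^ 3 * length terminals)
regions {p} 1≤p G td terminals = record
    { r = r ; region = region ; boundary = boundary ; portals = portals
    ; coverVertex = λ v → let t , v∈t = coverV v ; i , in-i = covers (bound t) in i , in-i (at t v∈t)
    ; coverEdge = λ {u} {v} e →
        let t , u∈t , v∈t = coverE u v e ; i , in-i = covers (bound t) in i , in-i (at t u∈t) , in-i (at t v∈t)
    ; unique = unique
    ; portal∈boundary = portal∈boundary } ,
  required⊆portals ,
  subst (λ s → ∑ (λ i → length (boundary i) ^ 4) ≤ 14 ^ 4 * p ^ 3 * (s + length terminals)) (sumTo-zero m) cost≤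
  where
  open TreeDecomposition td
  open Cutting 1≤p m (bag ∘ node td) (bagSize ∘ node td) (parentℕ td) (parentℕ≤ td) (∈parentℕ td)
  open Cut (cut m ℕ.≤-refl (initial terminals))
  bound : ∀ t → toℕ t ≤ m
  bound t = s≤s⁻¹ (Fin.toℕ<n t)
  at : ∀ {v} t → v ∈ bag t → v ∈ bag (node td (toℕ t))
  at t = subst (λ t → _ ∈ bag t) (≡.sym (node-toℕ td t))

theorem7 : ∃[ C ] (0 < C × (∀ (p : ℕ) → 1 ≤ p → ∀ (G : WGraph) → TreewidthAtMost (graph G) p →
    ∀ (k : ℕ) (term : Fin k → Fin (n (graph G))) → Injective _≡_ _≡_ term →
    ∃[ G' ] (DPMinor G k term G' × n (graph G') ≤ C * p ^ 3 * k)))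
theorem7 = 14 ^ 4 , ℕ.m≤m+n 1 38415 , λ p 1≤p G td k term term-injective →
  let R , terminal∈portals , cost≤ = regions 1≤p G td (tabulate term)
      geo = geodesics G
  in RegionMinor.minor geo R ,
     RegionMinor.dpMinor geo R term term-injective (terminal∈portals ∘ ∈-tabulate⁺) ,
     ℕ.≤-trans (RegionMinor.length-kept geo R) (subst (λ l → Regions.cost R ≤ 14 ^ 4 * p ^ 3 * l) (length-tabulate term) cost≤)
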